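{- Let $n\ge 1$ and $0\le k\le\frac{n(n-1)}{2}$ be integers, and let $\mathcal{S}(k,n)=L(00\cdots 0,\,k,\,n,\,0)$ be the ordered list produced by the procedure Gen1_Gray called with parameters $(k,n,0)$. Then the list of permutations obtained by applying $\psi$ to the successive terms of $\mathcal{S}(k,n)$ is a list of all the permutations in $\mathfrak{S}_n$ with major index equal to $k$, each appearing exactly once, and two consecutive permutations $\sigma,\tau$ in this list differ by at most three transpositions, i.e. $\tau=\sigma\cdot\theta_1\cdots\theta_m$ for some $m\le 3$ and some transpositions $\theta_1,\ldots,\theta_m\in\mathfrak{S}_n$.
   Context: $\mathfrak{S}_n$ is the set of permutations of $\{1,\ldots,n\}$, with product $(\sigma\cdot\tau)(i)=\sigma(\tau(i))$. The major index of $\pi\in\mathfrak{S}_n$ is the sum of all $i$, $1\le i<n$, with $\pi_i>\pi_{i+1}$. A subexcedant sequence of length $n$ is a sequence $c_1c_2\ldots c_n$ of integers with $0\le c_i\le i-1$ for all $i$; its weight is $\sum_i c_i$. $S(n)$ is the set of subexcedant sequences of length $n$, and $S(k,n)$ the set of those of weight $k$. For $0\le k<u\le n$, let $[[u,k]]\in\mathfrak{S}_n$ be the permutation obtained from the identity by $k$ right circular shifts of its length-$u$ prefix: $[[u,k]](i)=u-k+i$ for $1\le i\le k$, $[[u,k]](i)=i-k$ for $k<i\le u$, and $[[u,k]](i)=i$ for $i>u$. The map $\psi:S(n)\to\mathfrak{S}_n$ is $$\psi(t_1t_2\ldots t_n)=[[n,t_n]]\cdot[[n-1,t_{n-1}]]\cdot\ldots\cdot[[2,t_2]]\cdot[[1,t_1]].$$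 Procedure Gen1_Gray. For a length-$n$ sequence $\boldsymbol{c}$, integers $k\ge 0$, $r$, and $d\in\{0,1\}$, $L(\boldsymbol{c},k,r,d)$ denotes the ordered list output by the call Gen1_Gray$(k,r,d)$ when the current sequence is $\boldsymbol{c}$. Write $\boldsymbol{c}+x\varepsilon_i$ for the sequence obtained from $\boldsymbol{c}$ by adding $x$ to its $i$-th entry. The list is defined recursively: - If $k=0$, then $L(\boldsymbol{c},k,r,d)$ is the one-element list $(\boldsymbol{c})$. - If $k>0$, put $r'=r-1$ if $c_r=r-1$ and $r'=r$ otherwise; $\ell=\min\{s : \frac{s(s-1)}{2}\ge k\}$; $e=k-\frac{(\ell-1)(\ell-2)}{2}$. - If $d=0$, $L(\boldsymbol{c},k,r,0)$ is the concatenation, in this order, of $L(\boldsymbol{c}+e\varepsilon_\ell,\,k-e,\,\ell,\,0)$ and then, for $i=\ell+1,\ldots,r'$ (increasing), of $L(\boldsymbol{c}+\varepsilon_i,\,k-1,\,i,\,d_i)$, where $d_{\ell+1}=(r'-\ell)\bmod 2$ and the values $d_{\ell+1},d_{\ell+2},\ldots$ alternate between $0$ and $1$. - If $d=1$, $L(\boldsymbol{c},k,r,1)$ is the concatenation, in this order, for $i=r',r'-1,\ldots,\ell+1$ (decreasing), of $L(\boldsymbol{c}+\varepsilon_i,\,k-1,\,i,\,d_i)$, where $d_{r'}=0$ and the values $d_{r'},d_{r'-1},\ldots$ alternate between $0$ and $1$, followed by $L(\boldsymbol{c}+e\varepsilon_\ell,\,k-e,\,\ell,\,1)$. -}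

module Defs where

open import Data.Bool.Base using (if_then_else_)
open import Data.Fin.Base using (Fin; zero; suc; toℕ; fromℕ<; inject₁)
import Data.Fin.Properties as Fin
open import Data.Fin.Permutation using (Permutation′; permutation; id; transpose; _⟨$⟩ʳ_; _∘ₚ_; _≈_)
open import Data.List.Base using (List; []; _∷_; _++_; map; filter; foldr; concatMap; applyUpTo; applyDownFrom; allFin; length)
open import Data.List.Relation.Unary.All using (All)
open import Data.Nat.Base
open import Data.Nat.DivMod using (_/_; m*n/n≡m; /-monoˡ-≤)
open import Data.Nat.Induction using (Acc; acc; <-wellFounded)
open import Data.Nat.ListAction using (sum)
open import Data.Nat.Properties
open import Data.Parity.Base using (Parity; 0ℙ; 1ℙ; _⁻¹)
open import Data.Product using (Σ; ∃; ∃₂; _×_; _,_; proj₁; proj₂)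
open import Data.Vec.Base using (Vec; lookup; tabulate; replicate)
open import Function.Base using (_∘_)
open import Level using (0ℓ)
open import Relation.Binary.Bundles using (Setoid)
open import Relation.Binary.PropositionalEquality
open import Relation.Nullary using (Dec; yes; no; does; contradiction)
open import Relation.Nullary.Decidable using (_×-dec_)
open import Relation.Unary using (Pred; Decidable)

-- 𝔖ₙ is Permutation′ n, acting on 0, …, n−1: the point x : Fin n stands
-- for the integer toℕ x + 1.

infixr 9 _·_

-- (σ · τ)(i) = σ(τ(i)); the library's _∘ₚ_ composes the other way round.
_·_ : ∀ {n} → Permutation′ n → Permutation′ n → Permutation′ n
σ · τ = τ ∘ₚ σ

-- Permutations are identified when they agree pointwise.
permutationSetoid : ℕ → Setoid 0ℓ 0ℓ
permutationSetoid n = record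
  { Carrier       = Permutation′ n
  ; _≈_           = _≈_
  ; isEquivalence = record
    { refl  = λ _ → refl
    ; sym   = λ p i → sym (p i)
    ; trans = λ p q i → trans (p i) (q i)
    }
  }

majorIndex : ∀ {n} → Permutation′ n → ℕ
majorIndex {zero}  π = 0
majorIndex {suc m} π =
  sum (map (suc ∘ toℕ)
           (filter (λ i → (π ⟨$⟩ʳ suc i) Fin.<? (π ⟨$⟩ʳ inject₁ i)) (allFin m)))

IsTransposition : ∀ {n} → Permutation′ n → Set
IsTransposition θ = ∃₂ λ i j → i ≢ j × θ ≈ transpose i j

DifferByAtMost : ∀ {n} → ℕ → Permutation′ n → Permutation′ n → Set
DifferByAtMost {n} b σ τ =
  ∃ λ (θs : List (Permutation′ n)) →
    length θs ≤ b × All IsTransposition θs × τ ≈ σ · foldr _·_ id θs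

-- [[u,k]] on 0-based points: i ≤ k becomes x < k, and k < i ≤ u becomes
-- k ≤ x < u.
shift : ℕ → ℕ → ℕ → ℕ
shift u k x with x <? k | x <? u
... | yes _ | _     = u ∸ k + x
... | no _  | yes _ = x ∸ k
... | no _  | no _  = x

u∸k+x<u : ∀ {u k x} → k ≤ u → x < k → u ∸ k + x < u
u∸k+x<u {u} {k} k≤u x<k =
  <-≤-trans (+-monoʳ-< (u ∸ k) x<k) (≤-reflexive (m∸n+n≡m k≤u))

shift-< : ∀ {n u} k x → k ≤ u → u ≤ n → x < n → shift u k x < n
shift-< {n} {u} k x k≤u u≤n x<n with x <? k | x <? u
... | yes x<k | _     = <-≤-trans (u∸k+x<u k≤u x<k) u≤n
... | no _    | yes _ = ≤-<-trans (m∸n≤m x k) x<n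
... | no _    | no _  = x<n

shift-first : ∀ u k x → x < k → shift u k x ≡ u ∸ k + x
shift-first u k x x<k with x <? k | x <? u
... | yes _  | _ = refl
... | no x≮k | _ = contradiction x<k x≮k

shift-second : ∀ u k x → k ≤ x → x < u → shift u k x ≡ x ∸ k
shift-second u k x k≤x x<u with x <? k | x <? u
... | yes x<k | _      = contradiction k≤x (<⇒≱ x<k)
... | no _    | yes _  = refl
... | no _    | no x≮u = contradiction x<u x≮u

shift-third : ∀ u k x → k ≤ u → u ≤ x → shift u k x ≡ x
shift-third u k x k≤u u≤x with x <? k | x <? u
... | yes x<k | _       = contradiction (≤-trans k≤u u≤x) (<⇒≱ x<k)
... | no _    | yes x<u = contradiction u≤x (<⇒≱ x<u)
... | no _    | no _    = refl

shift-inverse : ∀ u k x → k ≤ u → shift u (u ∸ k) (shift u k x) ≡ x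
shift-inverse u k x k≤u with x <? k | x <? u
... | yes x<k | _ = trans
  (shift-second u (u ∸ k) (u ∸ k + x) (m≤m+n (u ∸ k) x) (u∸k+x<u k≤u x<k))
  (m+n∸m≡n (u ∸ k) x)
... | no x≮k | yes x<u = trans
  (shift-first u (u ∸ k) (x ∸ k) (∸-monoˡ-< x<u (≮⇒≥ x≮k)))
  (trans (cong (_+ (x ∸ k)) (m∸[m∸n]≡n k≤u)) (m+[n∸m]≡n (≮⇒≥ x≮k)))
... | no x≮k | no x≮u = shift-third u (u ∸ k) x (m∸n≤m u k) (≮⇒≥ x≮u)

shift-inverse′ : ∀ u k x → k ≤ u → shift u k (shift u (u ∸ k) x) ≡ x
shift-inverse′ u k x k≤u =
  subst (λ k′ → shift u k′ (shift u (u ∸ k) x) ≡ x) (m∸[m∸n]≡n k≤u)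
    (shift-inverse u (u ∸ k) x (m∸n≤m u k))

shiftFin : ∀ {n} u k → k ≤ u → u ≤ n → Fin n → Fin n
shiftFin u k k≤u u≤n x = fromℕ< (shift-< k (toℕ x) k≤u u≤n (Fin.toℕ<n x))

-- The inverse of k right shifts is u ∸ k further right shifts.
[[_,_]] : ∀ {n} (u k : ℕ) → k < u → u ≤ n → Permutation′ n
[[ u , k ]] k<u u≤n = permutation
  (shiftFin u k k≤u u≤n)
  (shiftFin u (u ∸ k) (m∸n≤m u k) u≤n)
  (λ x → Fin.toℕ-injective (trans (Fin.toℕ-fromℕ< _)
    (trans (cong (shift u k) (Fin.toℕ-fromℕ< _)) (shift-inverse′ u k (toℕ x) k≤u))))
  (λ x → Fin.toℕ-injective (trans (Fin.toℕ-fromℕ< _)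
    (trans (cong (shift u (u ∸ k)) (Fin.toℕ-fromℕ< _)) (shift-inverse u k (toℕ x) k≤u))))
  where
  k≤u : k ≤ u
  k≤u = <⇒≤ k<u

-- lookup c j is the 1-based entry c_{j+1}, so c_i ≤ i − 1 reads as follows.
Subexcedant : ∀ {n} → Vec ℕ n → Set
Subexcedant c = ∀ j → lookup c j ≤ toℕ j

S : ℕ → Set
S n = Σ (Vec ℕ n) Subexcedant

-- [[m,t_m]] · … · [[1,t_1]]
shiftProduct : ∀ {n} → S n → (m : ℕ) → m ≤ n → Permutation′ n
shiftProduct         t         zero    _   = id
shiftProduct {n} t@(c , sub) (suc m) m<n =
  [[ suc (toℕ j) , lookup c j ]] (s≤s (sub j)) (Fin.toℕ<n j)
    · shiftProduct t m (<⇒≤ m<n)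
  where
  j : Fin n
  j = fromℕ< m<n

ψ : ∀ {n} → S n → Permutation′ n
ψ {n} t = shiftProduct t n ≤-refl

triangle : ℕ → ℕ
triangle s = s * (s ∸ 1) / 2

IsLeast : Pred ℕ 0ℓ → Pred ℕ 0ℓ
IsLeast P s = P s × (∀ s′ → P s′ → s ≤ s′)

least : ∀ {P : Pred ℕ 0ℓ} → Decidable P → ∀ s → P s → ∃ (IsLeast P)
least P? zero    p = zero , p , λ _ _ → z≤n
least P? (suc s) p with P? 0
... | yes p₀ = zero , p₀ , λ _ _ → z≤n
... | no ¬p₀ with least (P? ∘ suc) s p
...   | m , pm , m-min = suc m , pm , λ
  { zero     p₀  → contradiction p₀ ¬p₀
  ; (suc s′) ps′ → s≤s (m-min s′ ps′) }

k≤triangle : ∀ k → k ≤ triangle (suc k)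
k≤triangle zero      = z≤n
k≤triangle k@(suc _) = ≤-trans
  (≤-reflexive (sym (m*n/n≡m k 2)))
  (/-monoˡ-≤ 2 (≤-trans (≤-reflexive (*-comm k 2))
                        (*-monoˡ-≤ k {2} {suc k} (s≤s (s≤s z≤n)))))

leastLevel : ∀ k → ∃ (IsLeast (λ s → k ≤ triangle s))
leastLevel k = least (λ s → k ≤? triangle s) (suc k) (k≤triangle k)

-- ℓ = min { s : s(s−1)/2 ≥ k } and e = k − (ℓ−1)(ℓ−2)/2.
level : ℕ → ℕ
level k = proj₁ (leastLevel k)

excess : ℕ → ℕ
excess k = k ∸ triangle (level k ∸ 1)

triangle-pred-level : ∀ k → 0 < k → triangle (level k ∸ 1) < k
triangle-pred-level k 0<k with leastLevel k
... | zero  , k≤0 , _     = contradiction k≤0 (<⇒≱ 0<k)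
... | suc s , _   , s-min = ≰⇒> λ k≤Ts → 1+n≰n (s-min s k≤Ts)

k∸excess<k : ∀ k → 0 < k → k ∸ excess k < k
k∸excess<k k 0<k = subst (_< k)
  (sym (m∸[m∸n]≡n (<⇒≤ (triangle-pred-level k 0<k))))
  (triangle-pred-level k 0<k)

-- c + xεᵢ for a 1-based index i; in the procedure's calls 1 ≤ i ≤ n.
_+[_]ε_ : ∀ {n} → Vec ℕ n → ℕ → ℕ → Vec ℕ n
c +[ x ]ε i = tabulate λ j →
  if does (suc (toℕ j) ≟ i) then lookup c j + x else lookup c j

-- c_r = r − 1, for a 1-based index r.
Full : ∀ {n} → Vec ℕ n → ℕ → Set
Full c r = ∃ λ j → suc (toℕ j) ≡ r × lookup c j ≡ r ∸ 1

full? : ∀ {n} (c : Vec ℕ n) r → Dec (Full c r)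
full? c r = Fin.any? λ j → (suc (toℕ j) ≟ r) ×-dec (lookup c j ≟ r ∸ 1)

-- r′ in the procedure
lastIndex : ∀ {n} → Vec ℕ n → ℕ → ℕ
lastIndex c r = if does (full? c r) then r ∸ 1 else r

-- ℓ+1, …, r′, empty if r′ ≤ ℓ
increasing : ℕ → ℕ → List ℕ
increasing ℓ r′ = applyUpTo (λ j → suc ℓ + j) (r′ ∸ ℓ)

-- r′, …, ℓ+1
decreasing : ℕ → ℕ → List ℕ
decreasing ℓ r′ = applyDownFrom (λ j → suc ℓ + j) (r′ ∸ ℓ)

-- The indices i paired with the directions dᵢ, the first one being d.
alternate : Parity → List ℕ → List (ℕ × Parity)
alternate d []       = []
alternate d (i ∷ is) = (i , d) ∷ alternate (d ⁻¹) is

-- The recursive procedure Gen1_Gray; the accessibility argument only serves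
-- termination.
gen : ∀ {n} → Vec ℕ n → (k : ℕ) → Acc _<_ k → ℕ → Parity → List (Vec ℕ n)
gen c zero      _        r d  = c ∷ []
gen c k@(suc _) (acc rs) r 0ℙ =
  let ℓ  = level k
      e  = excess k
      r′ = lastIndex c r
  in gen (c +[ e ]ε ℓ) (k ∸ e) (rs (k∸excess<k k z<s)) ℓ 0ℙ
     ++ concatMap (λ (i , dᵢ) → gen (c +[ 1 ]ε i) (k ∸ 1) (rs ≤-refl) i dᵢ)
                  (alternate (parity (r′ ∸ ℓ)) (increasing ℓ r′))
gen c k@(suc _) (acc rs) r 1ℙ =
  let ℓ  = level k
      e  = excess k
      r′ = lastIndex c r
  in concatMap (λ (i , dᵢ) → gen (c +[ 1 ]ε i) (k ∸ 1) (rs ≤-refl) i dᵢ)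
               (alternate 0ℙ (decreasing ℓ r′))
     ++ gen (c +[ e ]ε ℓ) (k ∸ e) (rs (k∸excess<k k z<s)) ℓ 1ℙ

L : ∀ {n} → Vec ℕ n → ℕ → ℕ → Parity → List (Vec ℕ n)
L c k r d = gen c k (<-wellFounded k) r d

𝒮 : (k n : ℕ) → List (Vec ℕ n)
𝒮 k n = L (replicate n 0) k n 0ℙ

{-# OPTIONS --safe #-}

-- Write R_m for the right circular shift of the length-m prefix.  Multiplying on
-- the left by R_m moves the descent next to the smallest of the values 1, …, m one
-- place to the right, so ψ turns weight into major index; and t_m can be read off
-- as m minus the m-th value, so ψ is bijective.  Since R_{i+1} = R_i · (1 i+1),
-- moving one unit between adjacent entries of t multiplies ψ(t) by a transposition,
-- even if the entries leave the range 0 ≤ t_i < i on the way.  The two directions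
-- of Gen1_Gray give reversed lists, so that consecutive blocks of the recursion meet
-- either in their first or in their last sequences.  These are explicit, and in each
-- case at most three such unit moves lead from one to the other.

module Submission where

open import Defs
open import Data.Bool.Base using (Bool; true; false; if_then_else_)
open import Data.Fin.Base using (Fin; zero; suc; toℕ; fromℕ<; inject₁)
open import Data.Fin.Permutation using (Permutation′; id; transpose; _⟨$⟩ʳ_; _⟨$⟩ˡ_; _≈_; inverseˡ)
import Data.Fin.Permutation.Components as PC
import Data.Fin.Properties as Fin
open import Data.List.Base using (List; []; _∷_; _++_; _∷ʳ_; map; filter; foldr; concatMap;
  applyUpTo; applyDownFrom; length; reverse; allFin)
import Data.List.Base as List
open import Data.List.Membership.Propositional using () renaming (_∈_ to _∈ₚ_)
open import Data.List.Membership.Propositional.Properties using (∈-++⁺ˡ; ∈-++⁺ʳ; ∈-++⁻)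
open import Data.List.Membership.Setoid using (_∈_)
import Data.List.Properties as List
open import Data.List.Relation.Binary.Permutation.Setoid using (↭-sym)
import Data.List.Relation.Binary.Permutation.Setoid.Properties as Perm
open import Data.List.Relation.Unary.All as All using (All; []; _∷_; toList)
open import Data.List.Relation.Unary.AllPairs as AllPairs using ([]; _∷_)
import Data.List.Relation.Unary.AllPairs.Properties as AllPairs
open import Data.List.Relation.Unary.Any as Any using (Any; here; there)
import Data.List.Relation.Unary.Any.Properties as Any
open import Data.List.Relation.Unary.Linked as Linked using (Linked; [-]; _∷_)
import Data.List.Relation.Unary.Linked.Properties as Linked
import Data.List.Relation.Unary.Unique.Propositional as Propositional
import Data.List.Relation.Unary.Unique.Propositional.Properties as Propositional
open import Data.List.Relation.Unary.Unique.Setoid using (Unique)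
open import Data.Nat.Base
open import Data.Nat.DivMod using (_/_; m*n/n≡m)
open import Data.Nat.Induction using (Acc; acc; <-wellFounded)
open import Data.Nat.ListAction using (sum)
open import Data.Nat.Properties
open import Data.Parity.Base as Parity using (Parity; 0ℙ; 1ℙ; _⁻¹)
import Data.Parity.Properties as Parity
open import Data.Product using (Σ; ∃; ∃₂; _×_; _,_; proj₁; proj₂)
open import Data.Sum.Base as Sum using (_⊎_; inj₁; inj₂)
open import Data.Vec.Base using (Vec; []; _∷_; lookup; tabulate; replicate)
import Data.Vec.Properties as Vec
open import Function.Base using (_∘_; case_of_)
open import Function.Bundles using (_⇔_; mk⇔)
open import Level using (0ℓ)
open import Relation.Binary.Definitions using (Symmetric; tri<; tri≈; tri>)
open import Relation.Binary.PropositionalEquality as ≡ hiding ([_])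
open import Relation.Nullary using (yes; no; does; contradiction)
open import Relation.Nullary.Decidable using (dec-true; dec-false)
open import Relation.Unary using (Pred; Decidable)

-- The recursive structure of Gen1_Gray

-- Throughout, `k = suc e + T s` with `e < s` encodes that the level is ℓ = s + 1 and the excess is
-- `suc e`. The leaf call, the one at index ℓ, leaves `T s` units for the s entries below ℓ, exactly
-- their capacity; so for d = 0 the first sequence of a call is explicit and independent of r. The
-- last sequence is the obstacle. For d = 1 a call begins with its block at r′, and d = 0 there, so
-- the last sequence of the call is the first one of that block. But r′ depends on whether entry r
-- is full, and if r′ = ℓ there is no block at all and the question passes to the leaf call.
-- `IsLast` records this recursion; it becomes explicit once an entry is full and the remaining
-- weight is the capacity below it. Three moves occur only where the leaf call meets the block at ℓ
-- + 1; any other two neighbouring blocks are at most two moves apart.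

reverse-concatMap : ∀ {a b} {A : Set a} {B : Set b} (f : A → List B) xs →
  reverse (concatMap f xs) ≡ concatMap (reverse ∘ f) (reverse xs)
reverse-concatMap f []       = refl
reverse-concatMap f (x ∷ xs) = begin
  reverse (f x ++ concatMap f xs)
    ≡⟨ List.reverse-++ (f x) _ ⟩
  reverse (concatMap f xs) ++ reverse (f x)
    ≡⟨ cong₂ _++_ (reverse-concatMap f xs) (sym (List.++-identityʳ _)) ⟩
  concatMap (reverse ∘ f) (reverse xs) ++ concatMap (reverse ∘ f) (x ∷ [])
    ≡⟨ List.concatMap-++ (reverse ∘ f) (reverse xs) (x ∷ []) ⟨
  concatMap (reverse ∘ f) (reverse xs ∷ʳ x)
    ≡⟨ cong (concatMap (reverse ∘ f)) (List.unfold-reverse x xs) ⟨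
  concatMap (reverse ∘ f) (reverse (x ∷ xs)) ∎
  where open ≡-Reasoning

-- The accessibility proofs reached inside the recursion are not those of `<-wellFounded`;
-- exchanging them lets every recursive call be written with `L` again.
gen-irrelevant : ∀ {n} (c : Vec ℕ n) k (p q : Acc _<_ k) r d →
  gen c k p r d ≡ gen c k q r d
gen-irrelevant c zero    p        q         r d  = refl
gen-irrelevant c (suc k) (acc ps) (acc qs) r 0ℙ = cong₂ _++_
  (gen-irrelevant (c +[ excess (suc k) ]ε level (suc k)) (suc k ∸ excess (suc k)) _ _ (level (suc k)) _)
  (List.concatMap-cong (λ (i , d) → gen-irrelevant (c +[ 1 ]ε i) k _ _ i d)
    (alternate (parity (lastIndex c r ∸ level (suc k))) (increasing (level (suc k)) (lastIndex c r))))
gen-irrelevant c (suc k) (acc ps) (acc qs) r 1ℙ = cong₂ _++_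
  (List.concatMap-cong (λ (i , d) → gen-irrelevant (c +[ 1 ]ε i) k _ _ i d)
    (alternate 0ℙ (decreasing (level (suc k)) (lastIndex c r))))
  (gen-irrelevant (c +[ excess (suc k) ]ε level (suc k)) (suc k ∸ excess (suc k)) _ _ (level (suc k)) _)

branch : ∀ {n} → Vec ℕ n → ℕ → ℕ × Parity → List (Vec ℕ n)
branch c k (i , d) = L (c +[ 1 ]ε i) k i d

leafCall : ∀ {n} → Vec ℕ n → ℕ → Parity → List (Vec ℕ n)
leafCall c k d = L (c +[ excess k ]ε level k) (k ∸ excess k) (level k) d

L-suc-0ℙ : ∀ {n} (c : Vec ℕ n) k r →
  L c (suc k) r 0ℙ ≡ leafCall c (suc k) 0ℙ ++
    concatMap (branch c k) (alternate (parity (lastIndex c r ∸ level (suc k)))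
                                      (increasing (level (suc k)) (lastIndex c r)))
L-suc-0ℙ c k r = cong₂ _++_
  (gen-irrelevant (c +[ excess (suc k) ]ε level (suc k)) (suc k ∸ excess (suc k)) _
    (<-wellFounded _) (level (suc k)) _)
  (List.concatMap-cong (λ (i , d) → gen-irrelevant (c +[ 1 ]ε i) k _ (<-wellFounded k) i d)
    (alternate (parity (lastIndex c r ∸ level (suc k))) (increasing (level (suc k)) (lastIndex c r))))

L-suc-1ℙ : ∀ {n} (c : Vec ℕ n) k r →
  L c (suc k) r 1ℙ ≡
    concatMap (branch c k) (alternate 0ℙ (decreasing (level (suc k)) (lastIndex c r)))
      ++ leafCall c (suc k) 1ℙ
L-suc-1ℙ c k r = cong₂ _++_
  (List.concatMap-cong (λ (i , d) → gen-irrelevant (c +[ 1 ]ε i) k _ (<-wellFounded k) i d)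
    (alternate 0ℙ (decreasing (level (suc k)) (lastIndex c r))))
  (gen-irrelevant (c +[ excess (suc k) ]ε level (suc k)) (suc k ∸ excess (suc k)) _
    (<-wellFounded _) (level (suc k)) _)

flip : ℕ × Parity → ℕ × Parity
flip (i , d) = i , d ⁻¹

parity-suc : ∀ m → parity (suc m) ≡ parity m ⁻¹
parity-suc m = trans (sym (Parity.⁻¹-involutive _)) (cong _⁻¹ (Parity.suc-homo-⁻¹ m))

alternate-∷ʳ : ∀ d is i →
  alternate d (is ∷ʳ i) ≡ alternate d is ∷ʳ (i , parity (length is) Parity.+ d)
alternate-∷ʳ d []       i = refl
alternate-∷ʳ d (j ∷ is) i = cong ((j , d) ∷_) (trans (alternate-∷ʳ (d ⁻¹) is i)
  (cong (λ p → alternate (d ⁻¹) is ∷ʳ (i , p)) (shift⁻¹ (parity (length is)) d (parity-suc (length is)))))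
  where
  shift⁻¹ : ∀ p {q} d → q ≡ p ⁻¹ → p Parity.+ d ⁻¹ ≡ q Parity.+ d
  shift⁻¹ 0ℙ 0ℙ refl = refl
  shift⁻¹ 0ℙ 1ℙ refl = refl
  shift⁻¹ 1ℙ 0ℙ refl = refl
  shift⁻¹ 1ℙ 1ℙ refl = refl

-- This is why d = 0 starts its blocks with the parity of r′ - ℓ: the alternation then arrives at r′
-- with the direction opposite to that of the call with d = 1. The start `d` is arbitrary because
-- removing the highest index flips it.
alternate-reverse : ∀ (f : ℕ → ℕ) m d →
  alternate (parity m Parity.+ d) (applyUpTo f m) ≡
    map flip (reverse (alternate d (applyDownFrom f m)))
alternate-reverse f zero    d = refl
alternate-reverse f (suc m) d = begin
  alternate (parity (suc m) Parity.+ d) (applyUpTo f (suc m))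
    ≡⟨ cong (alternate _) (List.applyUpTo-∷ʳ f m) ⟨
  alternate (parity (suc m) Parity.+ d) (applyUpTo f m ∷ʳ f m)
    ≡⟨ alternate-∷ʳ _ (applyUpTo f m) (f m) ⟩
  alternate (parity (suc m) Parity.+ d) (applyUpTo f m) ∷ʳ
    (f m , parity (length (applyUpTo f m)) Parity.+ (parity (suc m) Parity.+ d))
    ≡⟨ cong₂ (λ p q → alternate p (applyUpTo f m) ∷ʳ (f m , q)) (first (parity m) d (parity-suc m))
        (trans (cong (λ l → parity l Parity.+ (parity (suc m) Parity.+ d)) (List.length-applyUpTo f m))
          (last (parity m) d (parity-suc m))) ⟩
  alternate (parity m Parity.+ d ⁻¹) (applyUpTo f m) ∷ʳ (f m , d ⁻¹)
    ≡⟨ cong (_∷ʳ (f m , d ⁻¹)) (alternate-reverse f m (d ⁻¹)) ⟩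
  map flip (reverse (alternate (d ⁻¹) (applyDownFrom f m))) ∷ʳ flip (f m , d)
    ≡⟨ List.map-++ flip (reverse (alternate (d ⁻¹) (applyDownFrom f m))) ((f m , d) ∷ []) ⟨
  map flip (reverse (alternate (d ⁻¹) (applyDownFrom f m)) ∷ʳ (f m , d))
    ≡⟨ cong (map flip) (List.unfold-reverse (f m , d) (alternate (d ⁻¹) (applyDownFrom f m))) ⟨
  map flip (reverse (alternate d (applyDownFrom f (suc m)))) ∎
  where
  open ≡-Reasoning
  first : ∀ p {q} d → q ≡ p ⁻¹ → q Parity.+ d ≡ p Parity.+ d ⁻¹
  first 0ℙ 0ℙ refl = refl
  first 0ℙ 1ℙ refl = refl
  first 1ℙ 0ℙ refl = refl
  first 1ℙ 1ℙ refl = refl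
  last : ∀ p {q} d → q ≡ p ⁻¹ → p Parity.+ (q Parity.+ d) ≡ d ⁻¹
  last 0ℙ 0ℙ refl = refl
  last 0ℙ 1ℙ refl = refl
  last 1ℙ 0ℙ refl = refl
  last 1ℙ 1ℙ refl = refl

-- Exchanging the two values of d reverses the order of the calls and, by `alternate-reverse`, flips
-- each direction; the induction hypothesis reverses each call itself. The induction treats one
-- direction only, since the other follows from reversal being an involution.
L-reverse : ∀ {n} (c : Vec ℕ n) k r d → L c k r (d ⁻¹) ≡ reverse (L c k r d)
L-reverse c k r 1ℙ = byAcc c k (<-wellFounded k) r
  where
  byAcc : ∀ {n} (c : Vec ℕ n) k → Acc _<_ k → ∀ r → L c k r 0ℙ ≡ reverse (L c k r 1ℙ)
  byAcc c zero    _        r = refl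
  byAcc c (suc k) (acc rs) r = begin
    L c (suc k) r 0ℙ
      ≡⟨ L-suc-0ℙ c k r ⟩
    leafCall c (suc k) 0ℙ ++ concatMap (branch c k) (alternate (parity m) (applyUpTo f m))
      ≡⟨ cong₂ _++_ (byAcc _ _ (rs (k∸excess<k (suc k) z<s)) _)
          (cong (λ p → concatMap (branch c k) (alternate p (applyUpTo f m))) (sym (Parity.+-identityʳ (parity m)))) ⟩
    reverse (leafCall c (suc k) 1ℙ) ++ concatMap (branch c k) (alternate (parity m Parity.+ 0ℙ) (applyUpTo f m))
      ≡⟨ cong (λ is → reverse (leafCall c (suc k) 1ℙ) ++ concatMap (branch c k) is) (alternate-reverse f m 0ℙ) ⟩
    reverse (leafCall c (suc k) 1ℙ) ++ concatMap (branch c k) (map flip (reverse is))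
      ≡⟨ cong (reverse (leafCall c (suc k) 1ℙ) ++_) (List.concatMap-map (branch c k) flip (reverse is)) ⟩
    reverse (leafCall c (suc k) 1ℙ) ++ concatMap (branch c k ∘ flip) (reverse is)
      ≡⟨ cong (reverse (leafCall c (suc k) 1ℙ) ++_) (List.concatMap-cong (λ (i , d) → flipped i d) (reverse is)) ⟩
    reverse (leafCall c (suc k) 1ℙ) ++ concatMap (reverse ∘ branch c k) (reverse is)
      ≡⟨ cong (reverse (leafCall c (suc k) 1ℙ) ++_) (reverse-concatMap (branch c k) is) ⟨
    reverse (leafCall c (suc k) 1ℙ) ++ reverse (concatMap (branch c k) is)
      ≡⟨ List.reverse-++ (concatMap (branch c k) is) (leafCall c (suc k) 1ℙ) ⟨
    reverse (concatMap (branch c k) is ++ leafCall c (suc k) 1ℙ)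
      ≡⟨ cong reverse (L-suc-1ℙ c k r) ⟨
    reverse (L c (suc k) r 1ℙ) ∎
    where
    open ≡-Reasoning
    m : ℕ
    m = lastIndex c r ∸ level (suc k)
    f : ℕ → ℕ
    f j = suc (level (suc k)) + j
    is : List (ℕ × Parity)
    is = alternate 0ℙ (applyDownFrom f m)
    flipped : ∀ i d → branch c k (i , d ⁻¹) ≡ reverse (branch c k (i , d))
    flipped i 1ℙ = byAcc _ _ (rs ≤-refl) _
    flipped i 0ℙ = trans (sym (List.reverse-involutive _)) (cong reverse (sym (byAcc _ _ (rs ≤-refl) _)))
L-reverse c k r 0ℙ = trans (sym (List.reverse-involutive _)) (cong reverse (sym (L-reverse c k r 1ℙ)))

-- Triangular numbers, level and excess

T : ℕ → ℕ
T zero    = 0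
T (suc s) = s + T s

2*T : ∀ s → suc s * s ≡ T (suc s) * 2
2*T zero    = refl
2*T (suc s) = begin
  suc (suc s) * suc s           ≡⟨ *-comm (suc (suc s)) (suc s) ⟩
  suc s * suc (suc s)           ≡⟨ cong (suc s *_) (+-comm 2 s) ⟩
  suc s * (s + 2)               ≡⟨ *-distribˡ-+ (suc s) s 2 ⟩
  suc s * s + suc s * 2         ≡⟨ cong (_+ suc s * 2) (2*T s) ⟩
  T (suc s) * 2 + suc s * 2     ≡⟨ +-comm (T (suc s) * 2) _ ⟩
  suc s * 2 + T (suc s) * 2     ≡⟨ *-distribʳ-+ 2 (suc s) (T (suc s)) ⟨
  T (suc (suc s)) * 2           ∎
  where open ≡-Reasoning

triangle≡T : ∀ s → triangle s ≡ T s
triangle≡T zero    = refl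
triangle≡T (suc s) = trans (cong (_/ 2) (2*T s)) (m*n/n≡m (T (suc s)) 2)

T-mono : ∀ {s t} → s ≤ t → T s ≤ T t
T-mono z≤n       = z≤n
T-mono (s≤s s≤t) = +-mono-≤ s≤t (T-mono s≤t)

T-cancel-< : ∀ {s t} → T s < T t → s < t
T-cancel-< {s} {t} p = ≰⇒> λ t≤s → <⇒≱ p (T-mono t≤s)

-- `T (suc s)` reaches `k` because `suc e ≤ s`, while `T s` falls short of it by `suc e`.
level-unique : ∀ {e s k} → e < s → k ≡ suc e + T s → level k ≡ suc s
level-unique {e} {s} {k} e<s k≡ = ≤-antisym
  (least-level (suc s) (≤-trans (≤-reflexive k≡)
    (≤-trans (+-monoˡ-≤ (T s) e<s) (≤-reflexive (sym (triangle≡T (suc s)))))))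
  (T-cancel-< (<-≤-trans (≤-trans (s≤s (m≤n+m (T s) e)) (≤-reflexive (sym k≡)))
    (≤-trans k≤ (≤-reflexive (triangle≡T (level k))))))
  where
  k≤ : k ≤ triangle (level k)
  k≤ = proj₁ (proj₂ (leastLevel k))
  least-level : ∀ s′ → k ≤ triangle s′ → level k ≤ s′
  least-level = proj₂ (proj₂ (leastLevel k))

excess-unique : ∀ {e s k} → e < s → k ≡ suc e + T s → excess k ≡ suc e
excess-unique {e} {s} {k} e<s k≡ = begin
  k ∸ triangle (level k ∸ 1) ≡⟨ cong₂ (λ k ℓ → k ∸ triangle (ℓ ∸ 1)) k≡ (level-unique e<s k≡) ⟩
  suc e + T s ∸ triangle s   ≡⟨ cong (suc e + T s ∸_) (triangle≡T s) ⟩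
  suc e + T s ∸ T s          ≡⟨ m+n∸n≡m (suc e) (T s) ⟩
  suc e                      ∎
  where open ≡-Reasoning

infixl 20 _⊕[_]_

-- An opaque copy of _+[_]ε_, so that unification does not unfold it.
opaque
  _⊕[_]_ : ∀ {n} → Vec ℕ n → ℕ → ℕ → Vec ℕ n
  c ⊕[ x ] i = c +[ x ]ε i

-- With ℓ = s + 1, the topmost of `suc j` remaining blocks has index ℓ + 1 + j, so the recursion
-- ends with the block at ℓ + 1.
blocks : ∀ {n} → Vec ℕ n → ℕ → ℕ → ℕ → Parity → List (Vec ℕ n)
blocks c s k zero    d = []
blocks c s k (suc j) d = L (c ⊕[ 1 ] suc (suc (s + j))) k (suc (suc (s + j))) d ++ blocks c s k j (d ⁻¹)

opaque
  unfolding _⊕[_]_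

  -- Only d = 1 is unfolded: there the recursion peels off the highest index and the leaf call comes
  -- last. `L-reverse` supplies the other direction.
  L-blocks : ∀ {n} (c : Vec ℕ n) r {k e s m} → e < s → k ≡ suc e + T s → lastIndex c r ∸ suc s ≡ m →
    L c k r 1ℙ ≡ blocks c s (e + T s) m 0ℙ ++ L (c ⊕[ suc e ] suc s) (T s) (suc s) 1ℙ
  L-blocks c r {_} {e} {s} {m} e<s refl eq = begin
    L c (suc k) r 1ℙ
      ≡⟨ L-suc-1ℙ c k r ⟩
    concatMap (branch c k) (alternate 0ℙ (decreasing (level (suc k)) (lastIndex c r))) ++ leafCall c (suc k) 1ℙ
      ≡⟨ cong₂ (λ ℓ x → concatMap (branch c k) (alternate 0ℙ (decreasing ℓ (lastIndex c r)))
                         ++ L (c +[ x ]ε ℓ) (suc k ∸ x) ℓ 1ℙ)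
          (level-unique e<s refl) (excess-unique {e} {s} e<s refl) ⟩
    concatMap (branch c k) (alternate 0ℙ (decreasing (suc s) (lastIndex c r)))
      ++ L (c +[ suc e ]ε suc s) (k ∸ e) (suc s) 1ℙ
      ≡⟨ cong₂ (λ m x → concatMap (branch c k) (alternate 0ℙ (applyDownFrom (λ j → suc (suc s) + j) m))
                         ++ L (c +[ suc e ]ε suc s) x (suc s) 1ℙ)
          eq (m+n∸m≡n e (T s)) ⟩
    concatMap (branch c k) (alternate 0ℙ (applyDownFrom (λ j → suc (suc s) + j) m))
      ++ L (c +[ suc e ]ε suc s) (T s) (suc s) 1ℙ
      ≡⟨ cong (_++ L (c +[ suc e ]ε suc s) (T s) (suc s) 1ℙ) (go m 0ℙ) ⟩
    blocks c s k m 0ℙ ++ L (c +[ suc e ]ε suc s) (T s) (suc s) 1ℙ ∎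
    where
    open ≡-Reasoning
    k : ℕ
    k = e + T s
    go : ∀ m d → concatMap (branch c k) (alternate d (applyDownFrom (λ j → suc (suc s) + j) m)) ≡ blocks c s k m d
    go zero    d = refl
    go (suc m) d = cong (branch c k (suc (suc (s + m)) , d) ++_) (go m (d ⁻¹))

-- The procedure lists every reachable sequence exactly once

-- 0-based entries, padded with zeros beyond the end.
at : ∀ {n} → Vec ℕ n → ℕ → ℕ
at []      _       = 0
at (x ∷ c) zero    = x
at (x ∷ c) (suc q) = at c q

at-toℕ : ∀ {n} (c : Vec ℕ n) j → at c (toℕ j) ≡ lookup c j
at-toℕ (x ∷ c) zero    = refl
at-toℕ (x ∷ c) (suc j) = at-toℕ c j

at-fromℕ< : ∀ {n} (c : Vec ℕ n) {q} (q<n : q < n) → lookup c (fromℕ< q<n) ≡ at c q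
at-fromℕ< c q<n = trans (sym (at-toℕ c _)) (cong (at c) (Fin.toℕ-fromℕ< q<n))

at-≥ : ∀ {n} (c : Vec ℕ n) {q} → n ≤ q → at c q ≡ 0
at-≥ []      _         = refl
at-≥ (x ∷ c) (s≤s n≤q) = at-≥ c n≤q

lookup-ext : ∀ {n} {c c′ : Vec ℕ n} → (∀ j → lookup c j ≡ lookup c′ j) → c ≡ c′
lookup-ext {c = c} {c′} eq =
  trans (sym (Vec.tabulate∘lookup c)) (trans (Vec.tabulate-cong eq) (Vec.tabulate∘lookup c′))

at-ext : ∀ {n} {c c′ : Vec ℕ n} → (∀ q → at c q ≡ at c′ q) → c ≡ c′
at-ext {c = c} {c′} eq = lookup-ext λ j → trans (sym (at-toℕ c j)) (trans (eq (toℕ j)) (at-toℕ c′ j))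

addIf : Bool → ℕ → ℕ → ℕ
addIf b x a = if b then a + x else a

opaque
  unfolding _⊕[_]_

  lookup-ε : ∀ {n} (c : Vec ℕ n) x i j →
    lookup (c ⊕[ x ] i) j ≡ addIf (does (suc (toℕ j) ≟ i)) x (lookup c j)
  lookup-ε c x i j = Vec.lookup∘tabulate _ j

module _ {n : ℕ} (c : Vec ℕ n) where

  lookup-εε : ∀ x i y i′ j → lookup ((c ⊕[ x ] i) ⊕[ y ] i′) j ≡
    addIf (does (suc (toℕ j) ≟ i′)) y (addIf (does (suc (toℕ j) ≟ i)) x (lookup c j))
  lookup-εε x i y i′ j = trans (lookup-ε (c ⊕[ x ] i) y i′ j)
    (cong (addIf (does (suc (toℕ j) ≟ i′)) y) (lookup-ε c x i j))

  ε-comm : ∀ x i y i′ → (c ⊕[ x ] i) ⊕[ y ] i′ ≡ (c ⊕[ y ] i′) ⊕[ x ] i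
  ε-comm x i y i′ = lookup-ext λ j → trans (lookup-εε x i y i′ j)
    (trans (comm (does (suc (toℕ j) ≟ i)) (does (suc (toℕ j) ≟ i′)) (lookup c j))
      (sym (lookup-εε y i′ x i j)))
    where
    comm : ∀ b b′ a → addIf b′ y (addIf b x a) ≡ addIf b x (addIf b′ y a)
    comm true  true  a = trans (+-assoc a x y) (trans (cong (a +_) (+-comm x y)) (sym (+-assoc a y x)))
    comm true  false a = refl
    comm false true  a = refl
    comm false false a = refl

  ε-merge : ∀ x y i → (c ⊕[ x ] i) ⊕[ y ] i ≡ c ⊕[ x + y ] i
  ε-merge x y i = lookup-ext λ j → trans (lookup-εε x i y i j)
    (trans (merge (does (suc (toℕ j) ≟ i)) (lookup c j)) (sym (lookup-ε c (x + y) i j)))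
    where
    merge : ∀ b a → addIf b y (addIf b x a) ≡ addIf b (x + y) a
    merge true  a = +-assoc a x y
    merge false a = refl

  ε-zero : ∀ i → c ⊕[ 0 ] i ≡ c
  ε-zero i = lookup-ext λ j → trans (lookup-ε c 0 i j) (zeroIf (does (suc (toℕ j) ≟ i)) (lookup c j))
    where
    zeroIf : ∀ b a → addIf b 0 a ≡ a
    zeroIf true  a = +-identityʳ a
    zeroIf false a = refl

  at-ε : ∀ x {p} → p < n → at (c ⊕[ x ] suc p) p ≡ at c p + x
  at-ε x {p} p<n = begin
    at (c ⊕[ x ] suc p) p             ≡⟨ at-fromℕ< (c ⊕[ x ] suc p) p<n ⟨
    lookup (c ⊕[ x ] suc p) (fromℕ< p<n) ≡⟨ lookup-ε c x (suc p) (fromℕ< p<n) ⟩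
    addIf (does (suc (toℕ (fromℕ< p<n)) ≟ suc p)) x (lookup c (fromℕ< p<n))
      ≡⟨ cong₂ (λ b → addIf b x) (dec-true (_ ≟ _) (cong suc (Fin.toℕ-fromℕ< p<n))) (at-fromℕ< c p<n) ⟩
    at c p + x ∎
    where open ≡-Reasoning

  at-ε-≢ : ∀ x {p q} → q ≢ p → at (c ⊕[ x ] suc p) q ≡ at c q
  at-ε-≢ x {p} {q} q≢p with q <? n
  ... | no q≮n  = trans (at-≥ (c ⊕[ x ] suc p) (≮⇒≥ q≮n)) (sym (at-≥ c (≮⇒≥ q≮n)))
  ... | yes q<n = begin
    at (c ⊕[ x ] suc p) q             ≡⟨ at-fromℕ< (c ⊕[ x ] suc p) q<n ⟨
    lookup (c ⊕[ x ] suc p) (fromℕ< q<n) ≡⟨ lookup-ε c x (suc p) (fromℕ< q<n) ⟩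
    addIf (does (suc (toℕ (fromℕ< q<n)) ≟ suc p)) x (lookup c (fromℕ< q<n))
      ≡⟨ cong₂ (λ b → addIf b x)
          (dec-false (_ ≟ _) (λ eq → q≢p (trans (sym (Fin.toℕ-fromℕ< q<n)) (suc-injective eq))))
          (at-fromℕ< c q<n) ⟩
    at c q ∎
    where open ≡-Reasoning

  lastIndex-full : ∀ {p} → p < n → at c p ≡ p → lastIndex c (suc p) ≡ p
  lastIndex-full {p} p<n eq = cong (if_then p else suc p) (dec-true (full? c (suc p))
    (fromℕ< p<n , cong suc (Fin.toℕ-fromℕ< p<n) , trans (at-fromℕ< c p<n) eq))

  lastIndex-notFull : ∀ {p} → at c p ≢ p → lastIndex c (suc p) ≡ suc p
  lastIndex-notFull {p} neq = cong (if_then p else suc p) (dec-false (full? c (suc p))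
    λ (j , j≡p , eq) → neq (trans (cong (at c) (sym (suc-injective j≡p))) (trans (at-toℕ c j) eq)))

-- Partial sums and weights

sumTo : (ℕ → ℕ) → ℕ → ℕ
sumTo f zero    = 0
sumTo f (suc m) = f m + sumTo f m

sumTo-cong : ∀ {f g} m → (∀ i → i < m → f i ≡ g i) → sumTo f m ≡ sumTo g m
sumTo-cong zero    eq = refl
sumTo-cong (suc m) eq = cong₂ _+_ (eq m ≤-refl) (sumTo-cong m λ i i<m → eq i (m<n⇒m<1+n i<m))

sumTo-zero : ∀ {f} m → (∀ i → i < m → f i ≡ 0) → sumTo f m ≡ 0
sumTo-zero zero    eq = refl
sumTo-zero (suc m) eq = cong₂ _+_ (eq m ≤-refl) (sumTo-zero m λ i i<m → eq i (m<n⇒m<1+n i<m))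

sumTo-≤T : ∀ {f} m → (∀ i → f i ≤ i) → sumTo f m ≤ T m
sumTo-≤T zero    f≤ = z≤n
sumTo-≤T (suc m) f≤ = +-mono-≤ (f≤ m) (sumTo-≤T m f≤)

sumTo-bump : ∀ {f g q x} m → q < m → g q ≡ f q + x → (∀ {i} → i ≢ q → g i ≡ f i) →
  sumTo g m ≡ sumTo f m + x
sumTo-bump {f} {g} {q} {x} (suc m) q<1+m at-q off-q with q ≟ m
... | yes refl = begin
  g q + sumTo g q       ≡⟨ cong₂ _+_ at-q (sumTo-cong q λ i i<q → off-q (<⇒≢ i<q)) ⟩
  f q + x + sumTo f q   ≡⟨ +-assoc (f q) x _ ⟩
  f q + (x + sumTo f q) ≡⟨ cong (f q +_) (+-comm x _) ⟩
  f q + (sumTo f q + x) ≡⟨ +-assoc (f q) _ x ⟨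
  f q + sumTo f q + x   ∎
  where open ≡-Reasoning
... | no q≢m = trans
  (cong₂ _+_ (off-q (q≢m ∘ sym)) (sumTo-bump m (≤∧≢⇒< (s≤s⁻¹ q<1+m) q≢m) at-q off-q))
  (sym (+-assoc (f m) _ x))

-- Equality of the two tails above `s`, in additive form to avoid truncated subtraction.
sumTo-split : ∀ {f g s} m → s < m → (∀ i → s < i → f i ≡ g i) →
  sumTo f m + sumTo g (suc s) ≡ sumTo g m + sumTo f (suc s)
sumTo-split {f} {g} {s} (suc m) s<1+m eq with s ≟ m
... | yes refl = +-comm (sumTo f (suc s)) _
... | no s≢m   = begin
  f m + sumTo f m + sumTo g (suc s)   ≡⟨ +-assoc (f m) _ _ ⟩
  f m + (sumTo f m + sumTo g (suc s)) ≡⟨ cong₂ _+_ (eq m s<m) (sumTo-split m s<m eq) ⟩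
  g m + (sumTo g m + sumTo f (suc s)) ≡⟨ +-assoc (g m) _ _ ⟨
  g m + sumTo g m + sumTo f (suc s)   ∎
  where
  open ≡-Reasoning
  s<m : s < m
  s<m = ≤∧≢⇒< (s≤s⁻¹ s<1+m) s≢m

sumTo-mono : ∀ {f g} m → (∀ i → f i ≤ g i) → sumTo f m ≤ sumTo g m
sumTo-mono zero    f≤g = z≤n
sumTo-mono (suc m) f≤g = +-mono-≤ (f≤g m) (sumTo-mono m f≤g)

sumTo-≤-≡ : ∀ {f g} m → (∀ i → f i ≤ g i) → sumTo g m ≡ sumTo f m → ∀ i → i < m → f i ≡ g i
sumTo-≤-≡ {f} {g} (suc m) f≤g eq i i<1+m with f m ≟ g m
... | no neq = contradiction eq (<⇒≢ (+-mono-<-≤ (≤∧≢⇒< (f≤g m) neq) (sumTo-mono m f≤g)) ∘ sym)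
... | yes fm≡gm with i ≟ m
...   | yes refl = fm≡gm
...   | no i≢m   = sumTo-≤-≡ m f≤g
  (+-cancelˡ-≡ (g m) _ _ (trans eq (cong (_+ sumTo f m) fm≡gm))) i (≤∧≢⇒< (s≤s⁻¹ i<1+m) i≢m)

-- What holds of c, k and r = p + 1 in every call of Gen1_Gray(k, r, d).
record State {n : ℕ} (c : Vec ℕ n) (k p : ℕ) : Set where
  field
    p<n   : p < n
    below : ∀ q → q < p → at c q ≡ 0
    sub   : ∀ q → at c q ≤ q
    -- `T (suc p)` is the joint capacity of entries 0, ..., p, of which `below` lets only entry p be
    -- occupied.
    room  : k + at c p ≤ T (suc p)

-- Passing from `k` to its successor raises the excess until it equals `s`; then `k` is `T (suc s)`,
-- and the next weight has excess 1 at the next level.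
decompose : ∀ k → 0 < k → ∃₂ λ e s → e < s × k ≡ suc e + T s
decompose (suc zero)        _ = 0 , 1 , ≤-refl , refl
decompose (suc k@(suc _)) _ with decompose k z<s
... | e , s , e<s , k≡ with suc e ≟ s
...   | yes refl = 0 , suc s , z<s , cong suc k≡
...   | no neq   = suc e , s , ≤∧≢⇒< e<s neq , cong suc k≡

-- m is the number r′ − ℓ of calls besides the one at index ℓ = s + 1, where r = p + 1.
data Top {n : ℕ} (c : Vec ℕ n) (p s : ℕ) : ℕ → Set where
  free   : ∀ {m} → s + m ≡ p → at c p < p → Top c p s m
  closed : ∀ {m} → suc (s + m) ≡ p → at c p ≡ p → Top c p s m

module _ {n : ℕ} {c : Vec ℕ n} {p s : ℕ} where

  top-≤ : ∀ {m} → Top c p s m → s + m ≤ p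
  top-≤ (free refl _)   = ≤-refl
  top-≤ (closed refl _) = n≤1+n _

  top-block-≤ : ∀ {m j} → Top c p s m → j < m → suc (s + j) ≤ p
  top-block-≤ {m} {j} top j<m = ≤-trans (≤-reflexive (sym (+-suc s j)))
    (≤-trans (+-monoʳ-≤ s j<m) (top-≤ top))

  -- Among these entries only entry `p` can be occupied, and when it is full, r′ = r - 1 keeps the
  -- blocks away from it.
  top-block-< : ∀ {k m j} → State c k p → Top c p s m → j < m → at c (suc (s + j)) < suc (s + j)
  top-block-< {j = j} st top j<m with suc (s + j) ≟ p
  ... | no neq   = subst (_< suc (s + j)) (sym (State.below st _ (≤∧≢⇒< (top-block-≤ top j<m) neq))) z<s
  ... | yes refl with top
  ...   | free _ c<   = c<
  ...   | closed eq _ = contradiction eq (>⇒≢ (s≤s (+-monoʳ-< s j<m)))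

module _ {n : ℕ} {c : Vec ℕ n} {k p e s : ℕ} (st : State c k p) (e<s : e < s) (k≡ : k ≡ suc e + T s) where
  open State st

  level≤ : s ≤ p
  level≤ = s≤s⁻¹ (T-cancel-< (<-≤-trans (s≤s (m≤n+m (T s) e))
    (≤-trans (≤-reflexive (sym k≡)) (≤-trans (m≤m+n k (at c p)) room))))

  top : ∃ λ m → lastIndex c (suc p) ∸ suc s ≡ m × Top c p s m
  top with at c p ≟ p
  ... | no neq  = _ , cong (_∸ suc s) (lastIndex-notFull c neq) ,
    free (m+[n∸m]≡n level≤) (≤∧≢⇒< (sub p) neq)
  ... | yes full = _ , cong (_∸ suc s) (lastIndex-full c p<n full) , closed (m+[n∸m]≡n s<p) full
    where
    -- A full entry p uses up p of the capacity `T (suc p)`. What is left forces ℓ ≤ r′ = r - 1, so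
    -- that `r′ ∸ ℓ` is not truncated.
    k≤Tp : k ≤ T p
    k≤Tp = +-cancelˡ-≤ p k (T p) (≤-trans (≤-reflexive (trans (+-comm p k) (cong (k +_) (sym full)))) room)
    s<p : s < p
    s<p = T-cancel-< (<-≤-trans (s≤s (m≤n+m (T s) e)) (≤-trans (≤-reflexive (sym k≡)) k≤Tp))

  state-block : ∀ {q} → q ≤ p → s < q → at c q < q → State (c ⊕[ 1 ] suc q) (e + T s) q
  state-block {q} q≤p s<q c<q = record
    { p<n   = q<n
    ; below = λ i i<q → trans (at-ε-≢ c 1 (<⇒≢ i<q)) (below i (<-≤-trans i<q q≤p))
    ; sub   = λ i → case i ≟ q of λ
        { (yes refl) → ≤-trans (≤-reflexive c+1) c<q
        ; (no i≢q)   → ≤-trans (≤-reflexive (at-ε-≢ c 1 i≢q)) (sub i) }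
    ; room  = ≤-trans (≤-reflexive (+-comm (e + T s) _))
        (+-mono-≤ (≤-trans (≤-reflexive c+1) c<q)
          (≤-trans (+-monoˡ-≤ (T s) (<⇒≤ e<s)) (T-mono s<q)))
    }
    where
    q<n : q < n
    q<n = ≤-<-trans q≤p p<n
    c+1 : at (c ⊕[ 1 ] suc q) q ≡ suc (at c q)
    c+1 = trans (at-ε c 1 q<n) (+-comm (at c q) 1)

  s<n : s < n
  s<n = ≤-<-trans level≤ p<n

  at-leaf : at (c ⊕[ suc e ] suc s) s ≡ at c s + suc e
  at-leaf = at-ε c (suc e) s<n

  leaf-≤ : at c s + suc e ≤ s
  leaf-≤ with s ≟ p
  ... | no neq   = subst (λ x → x + suc e ≤ s) (sym (below s (≤∧≢⇒< level≤ neq))) e<s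
  -- Here ℓ = r, so entry ℓ may be occupied already; `room` is then its capacity `s` plus `T s`.
  ... | yes refl = +-cancelʳ-≤ (T s) _ _ (≤-trans (≤-reflexive (begin
    at c s + suc e + T s   ≡⟨ +-assoc (at c s) (suc e) (T s) ⟩
    at c s + (suc e + T s) ≡⟨ cong (at c s +_) k≡ ⟨
    at c s + k             ≡⟨ +-comm (at c s) k ⟩
    k + at c s             ∎)) room)
    where open ≡-Reasoning

  state-leaf : State (c ⊕[ suc e ] suc s) (T s) s
  state-leaf = record
    { p<n   = s<n
    ; below = λ i i<s → trans (at-ε-≢ c (suc e) (<⇒≢ i<s)) (below i (<-≤-trans i<s level≤))
    ; sub   = λ i → case i ≟ s of λ
        { (yes refl) → ≤-trans (≤-reflexive at-leaf) leaf-≤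
        ; (no i≢s)   → ≤-trans (≤-reflexive (at-ε-≢ c (suc e) i≢s)) (sub i) }
    ; room  = ≤-trans (≤-reflexive (+-comm (T s) _)) (+-monoˡ-≤ (T s) (≤-trans (≤-reflexive at-leaf) leaf-≤))
    }

-- Growth is required of entry `p` alone: entries above it are frozen, and below it `c` is zero in
-- every call.
record Reach {n : ℕ} (c : Vec ℕ n) (k p : ℕ) (v : Vec ℕ n) : Set where
  field
    sub    : ∀ q → at v q ≤ q
    above  : ∀ q → p < q → at v q ≡ at c q
    grow   : at c p ≤ at v p
    weight : sumTo (at v) n ≡ sumTo (at c) n + k

record Enumerates {n : ℕ} (c : Vec ℕ n) (k p : ℕ) (xs : List (Vec ℕ n)) : Set where
  field
    sound    : ∀ {v} → v ∈ₚ xs → Reach c k p v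
    complete : ∀ {v} → Reach c k p v → v ∈ₚ xs
    unique   : Propositional.Unique xs

enumerates-reverse : ∀ {n} {c : Vec ℕ n} {k p xs} → Enumerates c k p xs → Enumerates c k p (reverse xs)
enumerates-reverse {n} {xs = xs} en = record
  { sound    = sound ∘ Any.reverse⁻
  ; complete = Any.reverse⁺ ∘ complete
  ; unique   = Perm.Unique-resp-↭ vectors (↭-sym vectors (Perm.↭-reverse vectors xs)) unique
  }
  where
  open Enumerates en
  vectors = setoid (Vec ℕ n)

sumTo-ε : ∀ {n} (c : Vec ℕ n) x {q} → q < n → sumTo (at (c ⊕[ x ] suc q)) n ≡ sumTo (at c) n + x
sumTo-ε {n} c x q<n = sumTo-bump n q<n (at-ε c x q<n) (at-ε-≢ c x)

module _ {n : ℕ} {c : Vec ℕ n} {k p : ℕ} (st : State c k p) where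
  open State st

  reach-≤ : ∀ {v} → Reach c k p v → ∀ q → at c q ≤ at v q
  reach-≤ {v} r q with <-cmp q p
  ... | tri< q<p _ _  = subst (_≤ at v q) (sym (below q q<p)) z≤n
  ... | tri≈ _ refl _ = Reach.grow r
  ... | tri> _ _ p<q  = ≤-reflexive (sym (Reach.above r q p<q))

-- A reachable sequence dominates `c` entrywise; with no weight to add, the two coincide.
reach-zero : ∀ {n} {c : Vec ℕ n} {p v} → State c 0 p → Reach c 0 p v → v ≡ c
reach-zero {n} {c} {p} {v} st r = at-ext λ q → case q <? n of λ
  { (yes q<n) → sym (sumTo-≤-≡ n (reach-≤ st r) (trans weight (+-identityʳ _)) q q<n)
  ; (no q≮n)  → trans (at-≥ v (≮⇒≥ q≮n)) (sym (at-≥ c (≮⇒≥ q≮n))) }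
  where open Reach r

module _ {n : ℕ} {c : Vec ℕ n} {k p : ℕ} (st : State c k p) where
  open State st

  ε-sound : ∀ {x k′ q v} → q ≤ p → x + k′ ≡ k → Reach (c ⊕[ x ] suc q) k′ q v → Reach c k q v
  ε-sound {x} {k′} {q} {v} q≤p x+k′≡k r = record
    { sub    = sub′
    ; above  = λ i q<i → trans (above i q<i) (at-ε-≢ c x (>⇒≢ q<i))
    ; grow   = ≤-trans (m≤m+n _ x) (≤-trans (≤-reflexive (sym (at-ε c x q<n))) grow)
    ; weight = trans weight (trans (cong (_+ k′) (sumTo-ε c x q<n))
        (trans (+-assoc (sumTo (at c) n) x k′) (cong (sumTo (at c) n +_) x+k′≡k)))
    }
    where
    open Reach r renaming (sub to sub′)
    q<n = ≤-<-trans q≤p p<n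

  ε-complete : ∀ {x k′ q v} → q ≤ p → x + k′ ≡ k → at c q + x ≤ at v q →
    Reach c k q v → Reach (c ⊕[ x ] suc q) k′ q v
  ε-complete {x} {k′} {q} {v} q≤p x+k′≡k c+x≤v r = record
    { sub    = sub′
    ; above  = λ i q<i → trans (above i q<i) (sym (at-ε-≢ c x (>⇒≢ q<i)))
    ; grow   = ≤-trans (≤-reflexive (at-ε c x q<n)) c+x≤v
    ; weight = sym (trans (cong (_+ k′) (sumTo-ε c x q<n))
        (trans (+-assoc (sumTo (at c) n) x k′) (trans (cong (sumTo (at c) n +_) x+k′≡k) (sym weight))))
    }
    where
    open Reach r renaming (sub to sub′)
    q<n = ≤-<-trans q≤p p<n

  reach-up : ∀ {q v} → suc q ≤ p → Reach c k q v → Reach c k (suc q) v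
  reach-up {q} q<p r = record
    { sub    = sub′
    ; above  = λ i q<i → above i (<-trans ≤-refl q<i)
    ; grow   = ≤-reflexive (sym (above (suc q) ≤-refl))
    ; weight = weight
    }
    where open Reach r renaming (sub to sub′)

  reach-down : ∀ {q v} → suc q ≤ p → at v (suc q) ≡ at c (suc q) → Reach c k (suc q) v → Reach c k q v
  reach-down {q} {v} q<p eq r = record
    { sub    = sub′
    ; above  = λ i q<i → case suc q ≟ i of λ
        { (yes refl) → eq
        ; (no neq)   → above i (≤∧≢⇒< q<i neq) }
    ; grow   = subst (_≤ at v q) (sym (below q q<p)) z≤n
    ; weight = weight
    }
    where open Reach r renaming (sub to sub′)

-- Below index s + 1 there is room for T s only, so the remaining units must go to index s + 1.
leaf-forced : ∀ {n} {c : Vec ℕ n} {k p e s v} → State c k p → s ≤ p → k ≡ suc e + T s →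
  Reach c k s v → at c s + suc e ≤ at v s
leaf-forced {n} {c} {k} {p} {e} {s} {v} st s≤p k≡ r = +-cancelʳ-≤ (T s) _ _ (begin
  at c s + suc e + T s     ≡⟨ +-assoc (at c s) (suc e) (T s) ⟩
  at c s + (suc e + T s)   ≡⟨ cong (at c s +_) k≡ ⟨
  at c s + k               ≡⟨ cong (_+ k) (trans (cong (at c s +_) (sumTo-zero s λ i i<s → below i (<-≤-trans i<s s≤p)))
                                           (+-identityʳ (at c s))) ⟨
  sumTo (at c) (suc s) + k ≡⟨ prefix ⟩
  at v s + sumTo (at v) s  ≤⟨ +-monoʳ-≤ (at v s) (sumTo-≤T s sub′) ⟩
  at v s + T s             ∎)
  where
  open State st
  open Reach r renaming (sub to sub′)
  open ≤-Reasoning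
  prefix : sumTo (at c) (suc s) + k ≡ sumTo (at v) (suc s)
  prefix = +-cancelˡ-≡ (sumTo (at c) n) _ _ (begin-equality
    sumTo (at c) n + (sumTo (at c) (suc s) + k) ≡⟨ cong (sumTo (at c) n +_) (+-comm _ k) ⟩
    sumTo (at c) n + (k + sumTo (at c) (suc s)) ≡⟨ +-assoc (sumTo (at c) n) k _ ⟨
    sumTo (at c) n + k + sumTo (at c) (suc s)   ≡⟨ cong (_+ sumTo (at c) (suc s)) weight ⟨
    sumTo (at v) n + sumTo (at c) (suc s)       ≡⟨ sumTo-split n (≤-<-trans s≤p p<n) above ⟩
    sumTo (at c) n + sumTo (at v) (suc s)       ∎)

any-direction : ∀ {n} {c : Vec ℕ n} {k p} → Enumerates c k p (L c k (suc p) 1ℙ) →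
  ∀ d → Enumerates c k p (L c k (suc p) d)
any-direction                 en 1ℙ = en
any-direction {c = c} {k} {p} en 0ℙ =
  subst (Enumerates c k p) (sym (L-reverse c k (suc p) 1ℙ)) (enumerates-reverse en)

module _ {n : ℕ} {c : Vec ℕ n} {k p e s m : ℕ} (st : State c k p) (e<s : e < s) (k≡ : k ≡ suc e + T s)
         (t : Top c p s m)
         (smaller : ∀ {c k′ p} → k′ < k → State c k′ p → Enumerates {n} c k′ p (L c k′ (suc p) 1ℙ)) where

  private
    e+T<k : suc (e + T s) ≤ k
    e+T<k = ≤-reflexive (sym k≡)

    leaf′ : List (Vec ℕ n)
    leaf′ = L (c ⊕[ suc e ] suc s) (T s) (suc s) 1ℙ

    leaf-enumerates : Enumerates c k s leaf′
    leaf-enumerates = record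
      { sound    = λ v∈ → ε-sound st (level≤ st e<s k≡) (sym k≡) (sound v∈)
      ; complete = λ r → complete (ε-complete st (level≤ st e<s k≡) (sym k≡)
          (leaf-forced st (level≤ st e<s k≡) k≡ r) r)
      ; unique   = unique
      }
      where open Enumerates (smaller (≤-trans (s≤s (m≤n+m (T s) e)) e+T<k) (state-leaf st e<s k≡))

    -- Entry `q` decides: it exceeds its value in `c` for all sequences of the topmost block and
    -- keeps that value in all later ones. Completeness and disjointness both come from this
    -- distinction.
    blocks-enumerate : ∀ j d → j ≤ m → Enumerates c k (s + j) (blocks c s (e + T s) j d ++ leaf′)
    blocks-enumerate zero    d _   = subst (λ q → Enumerates c k q leaf′) (sym (+-identityʳ s)) leaf-enumerates
    blocks-enumerate (suc j) d j<m = subst₂ (Enumerates c k) (sym (+-suc s j))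
      (sym (List.++-assoc block (blocks c s (e + T s) j (d ⁻¹)) leaf′)) (record
      { sound    = λ v∈ → case ∈-++⁻ block v∈ of λ
          { (inj₁ v∈block) → ε-sound st q≤p (sym k≡) (Block.sound v∈block)
          ; (inj₂ v∈rest)  → reach-up st q≤p (Rest.sound v∈rest) }
      ; complete = λ {v} r → case at c q ≟ at v q of λ
          { (yes eq) → ∈-++⁺ʳ block (Rest.complete (reach-down st q≤p (sym eq) r))
          ; (no neq) → ∈-++⁺ˡ (Block.complete (ε-complete st q≤p (sym k≡)
              (≤-trans (≤-reflexive (+-comm (at c q) 1)) (≤∧≢⇒< (Reach.grow r) neq)) r)) }
      ; unique   = Propositional.++⁺ Block.unique Rest.unique λ (v∈block , v∈rest) →
          1+n≰n (≤-trans (≤-reflexive (trans (+-comm 1 (at c q)) (sym (at-ε c 1 q<n))))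
            (≤-trans (Reach.grow (Block.sound v∈block))
              (≤-reflexive (Reach.above (Rest.sound v∈rest) q ≤-refl))))
      })
      where
      q : ℕ
      q = suc (s + j)
      q≤p : q ≤ p
      q≤p = top-block-≤ t j<m
      q<n : q < n
      q<n = ≤-<-trans q≤p (State.p<n st)
      block : List (Vec ℕ n)
      block = L (c ⊕[ 1 ] suc q) (e + T s) (suc q) d
      module Block = Enumerates (any-direction (smaller e+T<k
        (state-block st e<s k≡ q≤p (s≤s (m≤m+n s j)) (top-block-< st t j<m))) d)
      module Rest = Enumerates (blocks-enumerate j (d ⁻¹) (<⇒≤ j<m))

    -- If entry `p` is full it cannot grow, so reaching from `p` and from the entry before it is the
    -- same; no block at r is missing.
    from-top : ∀ {m xs} → Top c p s m → Enumerates c k (s + m) xs → Enumerates c k p xs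
    from-top (free refl _)     en = en
    from-top (closed refl full) en = record
      { sound    = λ v∈ → reach-up st ≤-refl (sound v∈)
      ; complete = λ r → complete (reach-down st ≤-refl
          (≤-antisym (≤-trans (Reach.sub r p) (≤-reflexive (sym full))) (Reach.grow r)) r)
      ; unique   = unique
      }
      where open Enumerates en

  level-enumerates : lastIndex c (suc p) ∸ suc s ≡ m → Enumerates c k p (L c k (suc p) 1ℙ)
  level-enumerates m≡ = subst (Enumerates c k p) (sym (L-blocks c (suc p) e<s k≡ m≡))
    (from-top t (blocks-enumerate m 0ℙ ≤-refl))

L-enumerates′ : ∀ {n} {c : Vec ℕ n} {k p} → Acc _<_ k → State c k p → Enumerates c k p (L c k (suc p) 1ℙ)
L-enumerates′ {k = zero} _ st = record
  { sound    = λ { (here refl) → record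
      { sub = State.sub st ; above = λ _ _ → refl ; grow = ≤-refl ; weight = sym (+-identityʳ _) } }
  ; complete = λ r → here (reach-zero st r)
  ; unique   = [] ∷ []
  }
L-enumerates′ {k = k@(suc _)} (acc rs) st =
  let e , s , e<s , k≡ = decompose k z<s
      m , m≡ , t = top st e<s k≡
  in level-enumerates st e<s k≡ t (λ k′<k → L-enumerates′ (rs k′<k)) m≡

L-enumerates : ∀ {n} (c : Vec ℕ n) {k p} d → State c k p → Enumerates c k p (L c k (suc p) d)
L-enumerates c {k} d st = any-direction (L-enumerates′ (<-wellFounded k) st) d

-- Consecutive sequences

-- Carries both endpoints in its type: concatenation has to compare them and reversal exchanges
-- them.
data Path {A : Set} (R : A → A → Set) : A → List A → A → Set where
  [_]    : ∀ a → Path R a (a ∷ []) a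
  _∷_ : ∀ {a b c xs} → R a b → Path R b xs c → Path R a (a ∷ xs) c

module _ {A : Set} {R : A → A → Set} where

  path-++ : ∀ {a b c d xs ys} → Path R a xs b → R b c → Path R c ys d → Path R a (xs ++ ys) d
  path-++ [ a ]   bc q = bc ∷ q
  path-++ (r ∷ p) bc q = r ∷ path-++ p bc q

  path-reverse : Symmetric R → ∀ {a b xs} → Path R a xs b → Path R b (reverse xs) a
  path-reverse sym [ a ] = [ a ]
  path-reverse sym {a} {c} (_∷_ {xs = xs} r p) =
    subst (λ ys → Path R c ys a) (≡.sym (List.unfold-reverse a xs)) (path-++ (path-reverse sym p) (sym r) [ a ])

  path-linked : ∀ {a b xs} → Path R a xs b → Linked R xs
  path-linked [ a ]         = [-]
  path-linked (r ∷ [ _ ])   = r ∷ [-]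
  path-linked (r ∷ (s ∷ p)) = r ∷ path-linked (s ∷ p)

-- `g` is the sequence without the moving unit, so that neither side needs a subtraction.
Move : ∀ {n} → Vec ℕ n → Vec ℕ n → Set
Move {n} a b = ∃₂ λ g p → suc p < n × a ≡ g ⊕[ 1 ] suc p × b ≡ g ⊕[ 1 ] suc (suc p)

Step : ∀ {n} → Vec ℕ n → Vec ℕ n → Set
Step a b = Move a b ⊎ Move b a

infixr 5 _∷_

data Steps {n : ℕ} : ℕ → Vec ℕ n → Vec ℕ n → Set where
  done : ∀ {m a} → Steps m a a
  _∷_  : ∀ {m a b c} → Step a b → Steps m b c → Steps (suc m) a c

module _ {n : ℕ} where

  step-sym : Symmetric (Step {n})
  step-sym = Sum.swap

  steps-∷ʳ : ∀ {m} {a b c : Vec ℕ n} → Steps m a b → Step b c → Steps (suc m) a c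
  steps-∷ʳ done     t = t ∷ done
  steps-∷ʳ (s ∷ ss) t = s ∷ steps-∷ʳ ss t

  steps-sym : ∀ {m} → Symmetric (Steps {n} m)
  steps-sym done     = done
  steps-sym (s ∷ ss) = steps-∷ʳ (steps-sym ss) (step-sym s)

  move-ε : ∀ {a b : Vec ℕ n} x i → Move a b → Move (a ⊕[ x ] i) (b ⊕[ x ] i)
  move-ε x i (g , p , p< , refl , refl) =
    g ⊕[ x ] i , p , p< , ε-comm g 1 (suc p) x i , ε-comm g 1 (suc (suc p)) x i

  steps-ε : ∀ {m} {a b : Vec ℕ n} x i → Steps m a b → Steps m (a ⊕[ x ] i) (b ⊕[ x ] i)
  steps-ε x i done     = done
  steps-ε x i (s ∷ ss) = Sum.map (move-ε x i) (move-ε x i) s ∷ steps-ε x i ss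

  move-unit : ∀ (c : Vec ℕ n) x y {p} → suc p < n →
    Move ((c ⊕[ y ] suc (suc p)) ⊕[ suc x ] suc p) ((c ⊕[ suc y ] suc (suc p)) ⊕[ x ] suc p)
  move-unit c x y {p} p< = g , p , p< ,
    trans (cong (λ z → (c ⊕[ y ] suc (suc p)) ⊕[ z ] suc p) (+-comm 1 x)) (sym (ε-merge _ x 1 (suc p))) ,
    trans (cong (_⊕[ x ] suc p)
      (trans (cong (λ z → c ⊕[ z ] suc (suc p)) (+-comm 1 y)) (sym (ε-merge c y 1 (suc (suc p))))))
      (ε-comm _ 1 (suc (suc p)) x (suc p))
    where
    g = (c ⊕[ y ] suc (suc p)) ⊕[ x ] suc p

-- First and last sequences at the leaf call and the block next to it

full : ∀ {n} → Vec ℕ n → ℕ → Vec ℕ n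
full c zero    = c
full c (suc s) = full (c ⊕[ s ] suc s) s

steps-full : ∀ {n m} {a b : Vec ℕ n} s → Steps m a b → Steps m (full a s) (full b s)
steps-full zero    ss = ss
steps-full (suc s) ss = steps-full s (steps-ε s (suc s) ss)

-- With ℓ = u + 2 this is the window of indices ℓ - 1, ℓ, ℓ + 1, the only entries where the
-- sequences compared at the leaf call differ.
put : ∀ {n} → Vec ℕ n → ℕ → (x y z : ℕ) → Vec ℕ n
put c u x y z = ((c ⊕[ z ] (3 + u)) ⊕[ y ] (2 + u)) ⊕[ x ] (1 + u)

module _ {n : ℕ} (c : Vec ℕ n) {u : ℕ} (u< : 2 + u < n) where

  lower : ∀ x y z → Move (put c u (suc x) y z) (put c u x (suc y) z)
  lower x y z = move-unit (c ⊕[ z ] (3 + u)) x y (<-trans ≤-refl u<)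

  upper : ∀ x y z → Move (put c u x (suc y) z) (put c u x y (suc z))
  upper x y z = move-ε x (suc u) (move-unit c y z u<)

-- The last sequence of the call at index ℓ = u + 2, and the sequences of the call at
-- index ℓ + 1 it can be adjacent to.  Below index u + 1 all of them are full.
data LeafEnd {n : ℕ} (c : Vec ℕ n) : ℕ → ℕ → Vec ℕ n → Set where
  end₁ : ∀ {t e z} → z ≡ full (put c (suc t) t (2 + e) 0) (suc t) → LeafEnd c (suc t) e z
  end₂ : ∀ {u e z} → z ≡ full (put c u u (1 + e) 0) u             → LeafEnd c u e z

data BlockEnd {n : ℕ} (c : Vec ℕ n) : ℕ → ℕ → Vec ℕ n → Set where
  end₁ : ∀ {u e z} → z ≡ full (put c u u e 1) u             → BlockEnd c u e z
  end₂ : ∀ {u e z} → z ≡ full (put c u u e 2) u             → BlockEnd c u (suc e) z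
  end₃ : ∀ {t e z} → z ≡ full (put c (suc t) t (1 + e) 1) (suc t) → BlockEnd c (suc t) e z
  end₄ : ∀ {t e z} → z ≡ full (put c (suc t) t e 2) (suc t)       → BlockEnd c (suc t) e z

-- The constant three arises when the block holds two units at ℓ + 1 and the two sides disagree on
-- entry ℓ - 1, which is either `u` or one less: one move settles that entry, two carry units from ℓ
-- to ℓ + 1.
ends-near : ∀ {n} {c : Vec ℕ n} {u e b l} → 2 + u < n → BlockEnd c u e b → LeafEnd c u e l → Steps 3 l b
ends-near {c = c} u< (end₁ {u} {e} refl) (end₁ {t} refl) = steps-full u
  (inj₂ (lower c u< t (1 + e) 0) ∷ inj₁ (upper c u< u e 0) ∷ done)
ends-near {c = c} u< (end₁ {u} {e} refl) (end₂ refl) = steps-full u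
  (inj₁ (upper c u< u e 0) ∷ done)
ends-near {c = c} u< (end₂ {u} {e} refl) (end₁ {t} refl) = steps-full u
  (inj₂ (lower c u< t (2 + e) 0) ∷ inj₁ (upper c u< u (1 + e) 0) ∷ inj₁ (upper c u< u e 1) ∷ done)
ends-near {c = c} u< (end₂ {u} {e} refl) (end₂ refl) = steps-full u
  (inj₁ (upper c u< u (1 + e) 0) ∷ inj₁ (upper c u< u e 1) ∷ done)
ends-near {c = c} u< (end₃ {t} {e} refl) (end₁ refl) = steps-full (suc t)
  (inj₁ (upper c u< t (1 + e) 0) ∷ done)
ends-near {c = c} u< (end₃ {t} {e} refl) (end₂ refl) = steps-full (suc t)
  (inj₁ (lower c u< t (1 + e) 0) ∷ inj₁ (upper c u< t (1 + e) 0) ∷ done)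
ends-near {c = c} u< (end₄ {t} {e} refl) (end₁ refl) = steps-full (suc t)
  (inj₁ (upper c u< t (1 + e) 0) ∷ inj₁ (upper c u< t e 1) ∷ done)
ends-near {c = c} u< (end₄ {t} {e} refl) (end₂ refl) = steps-full (suc t)
  (inj₁ (lower c u< t (1 + e) 0) ∷ inj₁ (upper c u< t (1 + e) 0) ∷ inj₁ (upper c u< t e 1) ∷ done)

-- How e + T s is rewritten in the form used by decompose.
data Carry : (e s e′ s′ : ℕ) → Set where
  same   : ∀ {e s} → Carry (suc e) s e s
  borrow : ∀ {t} → Carry 0 (2 + t) t (1 + t)

decompose-≤ : ∀ {e s e′ s′} → e < s → suc e′ + T s′ ≡ suc e + T s → s′ ≤ s
decompose-≤ {e} {s} {e′} {s′} e<s eq = s≤s⁻¹ (T-cancel-<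
  (<-≤-trans (s≤s (m≤n+m (T s′) e′)) (≤-trans (≤-reflexive eq) (+-monoˡ-≤ (T s) e<s))))

decompose-unique : ∀ {e s e′ s′} → e < s → e′ < s′ → suc e + T s ≡ suc e′ + T s′ → e ≡ e′ × s ≡ s′
decompose-unique {e} {s} {e′} {s′} e<s e′<s′ eq
  with ≤-antisym (decompose-≤ {e′ = e} e′<s′ eq) (decompose-≤ {e′ = e′} e<s (sym eq))
... | refl = suc-injective (+-cancelʳ-≡ (T s) _ _ eq) , refl

carry : ∀ {e s e′ s′} → e ≤ s → e′ < s′ → e + T s ≡ suc e′ + T s′ → Carry e s e′ s′
-- `T (2 + t)` unfolds to `suc t + T (suc t)`: one level lower, with the largest possible excess.
carry {zero} {suc (suc t)} _ e′<s′ eq with decompose-unique {t} {suc t} ≤-refl e′<s′ eq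
... | refl , refl = borrow
carry {suc e} e<s e′<s′ eq with decompose-unique e<s e′<s′ eq
... | refl , refl = same

full-carry : ∀ {n} (c : Vec ℕ n) {e s e′ s′} → Carry e s e′ s′ →
  full (c ⊕[ e ] suc s) s ≡ full (c ⊕[ suc e′ ] suc s′) s′
full-carry c same         = refl
full-carry c (borrow {t}) = cong (λ c → full (c ⊕[ suc t ] suc (suc t)) (suc t)) (ε-zero c _)

full-zero : ∀ {n} (c : Vec ℕ n) {s} → T s ≡ 0 → full c s ≡ c
full-zero c {zero}     _ = refl
full-zero c {suc zero} _ = ε-zero c 1

-- z is the last sequence of L c k (p + 1) 0ℙ, which is the first one of L c k (p + 1) 1ℙ.
data IsLast {n : ℕ} (c : Vec ℕ n) (k p : ℕ) (z : Vec ℕ n) : Set where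
  nil    : k ≡ 0 → z ≡ c → IsLast c k p z
  opened : ∀ {e s} → e < s → k ≡ suc e + T s → s < p → at c p < p →
           z ≡ full ((c ⊕[ 1 ] suc p) ⊕[ e ] suc s) s → IsLast c k p z
  closed : ∀ {e s} → e < s → k ≡ suc e + T s → suc s < p → at c p ≡ p →
           z ≡ full ((c ⊕[ 1 ] p) ⊕[ e ] suc s) s → IsLast c k p z
  tight  : ∀ {e s} → e < s → k ≡ suc e + T s → Top c p s 0 →
           IsLast (c ⊕[ suc e ] suc s) (T s) s z → IsLast c k p z

-- Below a full entry `s` the capacity is exactly `T s`, so the next level is `s` itself and r′ = ℓ
-- again: no block occurs, only leaf calls down to the bottom.
last-full : ∀ {n} {c : Vec ℕ n} {s z} → State c (T s) s → at c s ≡ s → IsLast c (T s) s z → z ≡ full c s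
last-full {c = c} {s} st eq (nil T≡0 refl) = sym (full-zero c {s} T≡0)
last-full st eq (opened _ _ _ c< _) = contradiction eq (<⇒≢ c<)
last-full {s = s} st eq (closed e<s T≡ s+1<s _ _) with carry {0} {s} z≤n e<s T≡
... | borrow = contradiction s+1<s 1+n≰n
last-full st eq (tight _ _ (free _ c<) _) = contradiction eq (<⇒≢ c<)
last-full {s = s} st eq (tight {e} e<s T≡ (closed _ _) l) with carry {0} {s} z≤n e<s T≡
... | borrow = last-full (state-leaf st e<s T≡)
  (trans (at-leaf st e<s T≡) (cong (_+ suc e) (State.below st _ ≤-refl))) l

-- If entry ℓ is not yet full, it takes one more unit, which is then missing at ℓ - 1 (`end₁`). If
-- it is full, or no weight is left, everything below is full (`end₂`).
leaf-end : ∀ {n} {c : Vec ℕ n} {u e z} → State (c ⊕[ suc e ] (2 + u)) (T (suc u)) (suc u) →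
  IsLast (c ⊕[ suc e ] (2 + u)) (T (suc u)) (suc u) z → LeafEnd c u e z
leaf-end {n} {c} {u} {e} {z} st l = go l
  where
  b = c ⊕[ suc e ] (2 + u)
  pad : ∀ y → c ⊕[ y ] (2 + u) ≡ (c ⊕[ 0 ] (3 + u)) ⊕[ y ] (2 + u)
  pad y = cong (_⊕[ y ] (2 + u)) (sym (ε-zero c _))
  full-b : z ≡ full b (suc u) → LeafEnd c u e z
  full-b eq = end₂ (trans eq (cong (λ x → full x (suc u)) (pad (suc e))))
  go : IsLast b (T (suc u)) (suc u) z → LeafEnd c u e z
  go (nil T≡0 refl) = full-b (sym (full-zero b {suc u} T≡0))
  go (opened e<s T≡ _ _ z≡) with carry {0} {suc u} z≤n e<s T≡
  ... | borrow {t} = end₁ (trans z≡ (cong (λ x → full (x ⊕[ t ] (2 + t)) (suc t))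
    (trans (ε-merge c (suc e) 1 _) (trans (cong (λ y → c ⊕[ y ] (3 + t)) (+-comm (suc e) 1)) (pad (2 + e))))))
  go (closed e<s T≡ s+1<s _ _) with carry {0} {suc u} z≤n e<s T≡
  ... | borrow = contradiction s+1<s 1+n≰n
  go (tight e<s T≡ (free s≡ _) _) with carry {0} {suc u} z≤n e<s T≡
  ... | borrow {t} = contradiction (trans (sym s≡) (+-identityʳ (suc t))) 1+n≢n
  go (tight e<s T≡ (closed _ eq) l′) = full-b (last-full st eq l)

-- A second unit at ℓ + 1 gives `end₂` or `end₄`. If that entry is full, the block either puts a
-- unit on ℓ directly (`end₃`) or consists of its own leaf call, where `leaf-end` applies. Without
-- remaining weight the sequence is of the form `end₁`.
block-end : ∀ {n} {c : Vec ℕ n} {u e z} → e ≤ u → 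
  State (c ⊕[ 1 ] (3 + u)) (e + T (suc u)) (2 + u) →
  IsLast (c ⊕[ 1 ] (3 + u)) (e + T (suc u)) (2 + u) z → BlockEnd c u e z
block-end {n} {c} {u} {e} {z} e≤u st l = go l
  where
  b = c ⊕[ 1 ] (3 + u)
  carry′ : ∀ {e′ s′} → e′ < s′ → e + T (suc u) ≡ suc e′ + T s′ → Carry e (suc u) e′ s′
  carry′ = carry (m≤n⇒m≤1+n e≤u)
  go : IsLast b (e + T (suc u)) (2 + u) z → BlockEnd c u e z
  go (nil k≡0 refl) with m+n≡0⇒m≡0 e k≡0
  ... | refl = end₁ (sym (trans (cong (λ c → full c (suc u)) (ε-zero b _)) (full-zero b {suc u} k≡0)))
  go (opened e<s k≡ _ _ z≡) with carry′ e<s k≡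
  ... | same   = end₂ (trans z≡ (cong (λ c → full (c ⊕[ _ ] (2 + u)) (suc u)) (ε-merge c 1 1 _)))
  ... | borrow {t} = end₄ (trans z≡ (cong (λ c → full (c ⊕[ t ] (2 + t)) (suc t))
    (trans (ε-merge c 1 1 _) (sym (ε-zero _ _)))))
  go (closed e<s k≡ s< _ z≡) with carry′ e<s k≡
  ... | same   = contradiction s< 1+n≰n
  ... | borrow = end₃ z≡
  go (tight e<s k≡ (free s≡ _) _) with carry′ e<s k≡
  ... | same       = contradiction (trans (sym s≡) (+-identityʳ (suc u))) 1+n≢n
  ... | borrow {t} = contradiction (trans (sym s≡) (+-identityʳ (suc t))) (<⇒≢ (m<n⇒m<1+n ≤-refl) ∘ sym)
  go (tight {e′} e<s k≡ (closed s≡ _) l′) with carry′ e<s k≡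
  ... | borrow {t} = contradiction (trans (sym s≡) (+-identityʳ (2 + t))) 1+n≢n
  ... | same with leaf-end {c = b} (state-leaf st e<s k≡) l′
  ...   | end₁ {t} eq = end₃ (trans eq (cong (λ c → full ((c ⊕[ 2 + e′ ] (3 + t)) ⊕[ t ] (2 + t)) (suc t))
    (ε-zero b _)))
  ...   | end₂ eq = end₁ (trans eq (cong (λ c → full ((c ⊕[ suc e′ ] (2 + u)) ⊕[ u ] (1 + u)) u)
    (ε-zero b _)))

-- The first sequence of L c (e + T s) r 0ℙ, for every r.
first : ∀ {n} → Vec ℕ n → ℕ → ℕ → Vec ℕ n
first c e s = full (c ⊕[ e ] suc s) s

module _ {n : ℕ} {c : Vec ℕ n} {k p e s q : ℕ} (st : State c k p) (e<s : e < s) (s<q : s < q) (q<p : q < p) where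
  open State st

  private
    b b′ : Vec ℕ n
    b  = c ⊕[ 1 ] suc q
    b′ = c ⊕[ 1 ] suc (suc q)
    q′<n : suc q < n
    q′<n = ≤-<-trans q<p p<n
    k≢0 : ∀ {k′} → e + T s ≡ 0 → e + T s ≢ suc k′
    k≢0 eq eq′ with trans (sym eq) eq′
    ... | ()
    s′≤s : ∀ {e′ s′} → e′ < s′ → e + T s ≡ suc e′ + T s′ → s′ ≤ s
    s′≤s e′<s′ eq with carry (<⇒≤ e<s) e′<s′ eq
    ... | same   = ≤-refl
    ... | borrow = n≤1+n _
    notFull : at b q ≢ q
    notFull eq = <⇒≢ (≤-<-trans (s≤s z≤n) (≤-<-trans e<s s<q))
      (trans (sym (trans (at-ε c 1 (<-trans ≤-refl q′<n)) (cong (_+ 1) (below q q<p)))) eq)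

  firsts-near : Steps 3 (first b′ e s) (first b e s)
  firsts-near = steps-full s (steps-ε e (suc s) (inj₂ (c , q , q′<n , refl , refl) ∷ done))

  -- The lower block has a single unit in entry `q`, since `c` is zero there, and `e < s < q` gives
  -- q ≥ 2; so it can take a second one. The upper block takes its second unit in its own entry or,
  -- if that is full, in entry `q`. The rest of the weight is placed alike in both.
  lasts-near : ∀ {z z′} → IsLast b (e + T s) q z → IsLast b′ (e + T s) (suc q) z′ → Steps 3 z′ z
  lasts-near (nil _ refl) (nil _ refl) = inj₂ (c , q , q′<n , refl , refl) ∷ done
  lasts-near (nil eq _) (opened _ eq′ _ _ _) = contradiction eq′ (k≢0 eq)
  lasts-near (nil eq _) (closed _ eq′ _ _ _) = contradiction eq′ (k≢0 eq)
  lasts-near (nil eq _) (tight _ eq′ _ _)    = contradiction eq′ (k≢0 eq)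
  lasts-near (opened _ eq′ _ _ _) (nil eq _) = contradiction eq′ (k≢0 eq)
  lasts-near (opened {e₂} {s₂} e₂<s₂ eq _ _ refl) (opened e₃<s₃ eq′ _ _ refl)
    with decompose-unique e₂<s₂ e₃<s₃ (trans (sym eq) eq′)
  ... | refl , refl = steps-full s₂ (steps-ε e₂ (suc s₂)
    ( inj₂ (b′ , q , q′<n , refl , refl)
    ∷ inj₂ (b , q , q′<n , refl , ε-comm c 1 (suc (suc q)) 1 (suc q) ) ∷ done))
  lasts-near (opened {e₂} {s₂} e₂<s₂ eq _ _ refl) (closed e₃<s₃ eq′ _ _ refl)
    with decompose-unique e₂<s₂ e₃<s₃ (trans (sym eq) eq′)
  ... | refl , refl = steps-full s₂ (steps-ε e₂ (suc s₂)
    (inj₂ (b , q , q′<n , refl , ε-comm c 1 (suc (suc q)) 1 (suc q)) ∷ done))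
  lasts-near (closed _ _ _ eq _)          _ = contradiction eq notFull
  lasts-near (tight _ _ (closed _ eq) _)  _ = contradiction eq notFull
  lasts-near (tight {s = s₂} e₂<s₂ eq (free s₂≡q _) _) _ =
    contradiction (trans (sym (+-identityʳ s₂)) s₂≡q) (<⇒≢ (≤-<-trans (s′≤s e₂<s₂ eq) s<q))
  lasts-near _ (tight {s = s₂} e₂<s₂ eq t _) =
    contradiction (top-tight t) (<⇒≱ (s≤s (≤-<-trans (s′≤s e₂<s₂ eq) s<q)))
    where
    top-tight : Top b′ (suc q) s₂ 0 → suc q ≤ suc s₂
    top-tight (free s₂≡ _)  = ≤-trans (≤-reflexive (trans (sym s₂≡) (+-identityʳ s₂))) (n≤1+n s₂)
    top-tight (closed s₂≡ _) = ≤-reflexive (trans (sym s₂≡) (cong suc (+-identityʳ s₂)))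

-- Adjacency of consecutive sequences throughout a call

Near : ∀ {n} → Vec ℕ n → Vec ℕ n → Set
Near = Steps 3

module _ {n : ℕ} {c : Vec ℕ n} {k p : ℕ} (st : State c k p) where
  open State st

  -- The first sequence of the block at ℓ + 1 already has the form `BlockEnd.end₁`, so `ends-near`
  -- serves whichever end of the block faces the leaf call.
  first-leaf-near : ∀ {e s q z} → e < s → k ≡ suc e + T s → s < p → q ≡ suc s →
    IsLast (c ⊕[ suc e ] suc s) (T s) s z → Near (first (c ⊕[ 1 ] suc q) e s) z
  first-leaf-near e<s@(s≤s e≤u) k≡ s<p refl l =
    steps-sym (ends-near (≤-<-trans s<p p<n) (end₁ refl) (leaf-end (state-leaf st e<s k≡) l))

  last-leaf-near : ∀ {e s q z z′} → e < s → k ≡ suc e + T s → s < p → q ≡ suc s → at c q < q →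
    IsLast (c ⊕[ 1 ] suc q) (e + T s) q z → IsLast (c ⊕[ suc e ] suc s) (T s) s z′ → Near z z′
  last-leaf-near e<s@(s≤s e≤u) k≡ s<p refl c< b l =
    steps-sym (ends-near (≤-<-trans s<p p<n)
      (block-end e≤u (state-block st e<s k≡ s<p ≤-refl c<) b) (leaf-end (state-leaf st e<s k≡) l))

-- `e` and `s` are parameters because the caller knows the remaining weight as `e + T s`, where `e`
-- may be 0 and the form is not that of `decompose`; `full-carry` identifies the two versions of the
-- endpoint.
record Listed {n : ℕ} (c : Vec ℕ n) (k p e s : ℕ) (xs : List (Vec ℕ n)) : Set where
  constructor listed
  field
    {start} : Vec ℕ n
    isLast  : IsLast c k p start
    path    : Path Near start xs (first c e s)

L-path-reverse : ∀ {n} (c : Vec ℕ n) k r {a b} → Path Near a (L c k r 1ℙ) b → Path Near b (L c k r 0ℙ) a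
L-path-reverse c k r {a} {b} path =
  subst (λ xs → Path Near b xs a) (sym (L-reverse c k r 1ℙ)) (path-reverse steps-sym path)

module _ {n : ℕ} {c : Vec ℕ n} {k p e s m : ℕ} (st : State c k p) (e<s : e < s) (k≡ : k ≡ suc e + T s)
         (t : Top c p s m)
         (smaller : ∀ {c k′ p e s} → k′ < k → e ≤ s → k′ ≡ e + T s → State c k′ p →
                    Listed {n} c k′ p e s (L c k′ (suc p) 1ℙ)) where

  private
    c′ : Vec ℕ n
    c′ = c ⊕[ suc e ] suc s

    e+T<k : suc (e + T s) ≤ k
    e+T<k = ≤-reflexive (sym k≡)

    -- The tail with `j` blocks left begins inside its topmost block, with the explicit first
    -- sequence or with the last one according to the direction; with no block left, it begins with
    -- the last sequence of the leaf call.
    Start : ℕ → Parity → Vec ℕ n → Set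
    Start zero    _  z = IsLast c′ (T s) s z
    Start (suc j) 0ℙ z = z ≡ first (c ⊕[ 1 ] suc (suc (s + j))) e s
    Start (suc j) 1ℙ z = IsLast (c ⊕[ 1 ] suc (suc (s + j))) (e + T s) (suc (s + j)) z

    block : ℕ → Parity → List (Vec ℕ n)
    block j d = L (c ⊕[ 1 ] suc (suc (s + j))) (e + T s) (suc (suc (s + j))) d

    leaf : List (Vec ℕ n)
    leaf = L c′ (T s) (suc s) 1ℙ

    leaf-listed : Listed c′ (T s) s 0 s leaf
    leaf-listed = smaller (≤-trans (s≤s (m≤n+m (T s) e)) e+T<k) z≤n refl (state-leaf st e<s k≡)

    block-listed : ∀ {j} → j < m → Listed (c ⊕[ 1 ] suc (suc (s + j))) (e + T s) (suc (s + j)) e s (block j 1ℙ)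
    block-listed {j} j<m = smaller e+T<k (<⇒≤ e<s) refl
      (state-block st e<s k≡ (top-block-≤ t j<m) (s≤s (m≤m+n s j)) (top-block-< st t j<m))

    last-near : ∀ j {z z′} → j < m → IsLast (c ⊕[ 1 ] suc (suc (s + j))) (e + T s) (suc (s + j)) z →
      Start j 1ℙ z′ → Near z z′
    last-near zero    j<m l l′ = last-leaf-near st e<s k≡ (≤-trans (s≤s (m≤m+n s 0)) (top-block-≤ t j<m))
      (cong suc (+-identityʳ s)) (top-block-< st t j<m) l l′
    last-near (suc j) {z} j<m l l′ = lasts-near st e<s (s≤s (m≤m+n s j)) (subst (_≤ p) 2+q≡ (top-block-≤ t j<m)) l′
      (subst (λ q → IsLast (c ⊕[ 1 ] suc q) (e + T s) q z) 2+q≡ l)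
      where
      2+q≡ : suc (s + suc j) ≡ suc (suc (s + j))
      2+q≡ = cong suc (+-suc s j)

    first-near : ∀ j {z} → j < m → Start j 0ℙ z → Near (first (c ⊕[ 1 ] suc (suc (s + j))) e s) z
    first-near zero    j<m l    = first-leaf-near st e<s k≡ (≤-trans (s≤s (m≤m+n s 0)) (top-block-≤ t j<m))
      (cong suc (+-identityʳ s)) l
    first-near (suc j) j<m refl =
      subst (λ q → Near (first (c ⊕[ 1 ] suc q) e s) (first (c ⊕[ 1 ] suc (suc (s + j))) e s)) (sym 2+q≡)
      (firsts-near st e<s (s≤s (m≤m+n s j)) (subst (_≤ p) 2+q≡ (top-block-≤ t j<m)))
      where
      2+q≡ : suc (s + suc j) ≡ suc (suc (s + j))
      2+q≡ = cong suc (+-suc s j)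

    blocks-listed : ∀ j d → j ≤ m → ∃ λ z → Start j d z ×
      Path Near z (blocks c s (e + T s) j d ++ leaf) (first c (suc e) s)
    -- The leaf call has excess 0 in the parametrization of `Listed`; its endpoint `first c′ 0 s`
    -- differs from `first c (suc e) s` only by adding 0 at ℓ.
    blocks-listed zero d _ with listed isLast path ← leaf-listed =
      _ , isLast , subst (λ x → Path Near _ leaf (full x s)) (ε-zero c′ (suc s)) path
    blocks-listed (suc j) 0ℙ j<m
      with listed isLast path ← block-listed j<m
         | _ , start-rest , rest ← blocks-listed j 1ℙ (<⇒≤ j<m) =
      _ , refl , subst (λ xs → Path Near (first (c ⊕[ 1 ] suc (suc (s + j))) e s) xs (first c (suc e) s))
          (sym (List.++-assoc (block j 0ℙ) (blocks c s (e + T s) j 1ℙ) leaf))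
        (path-++ (L-path-reverse (c ⊕[ 1 ] suc (suc (s + j))) (e + T s) (suc (suc (s + j))) path)
          (last-near j j<m isLast start-rest) rest)
    blocks-listed (suc j) 1ℙ j<m
      with listed isLast path ← block-listed j<m
         | _ , start-rest , rest ← blocks-listed j 0ℙ (<⇒≤ j<m) =
      _ , isLast , subst (λ xs → Path Near _ xs (first c (suc e) s))
          (sym (List.++-assoc (block j 1ℙ) (blocks c s (e + T s) j 0ℙ) leaf))
        (path-++ path (first-near j j<m start-rest) rest)

    -- The constructors match r′ = r > ℓ, r′ = r - 1 > ℓ and r′ = ℓ.
    start-isLast : ∀ {m z} → Top c p s m → Start m 0ℙ z → IsLast c k p z
    start-isLast {zero} t l = tight e<s k≡ t l
    start-isLast {suc j} (free s+m≡p c<) refl with trans (sym (+-suc s j)) s+m≡p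
    ... | refl = opened e<s k≡ (s≤s (m≤m+n s j)) c< refl
    start-isLast {suc j} (closed s+m≡p c≡) refl with trans (cong suc (sym (+-suc s j))) s+m≡p
    ... | refl = closed e<s k≡ (s≤s (s≤s (m≤m+n s j))) c≡ refl

  level-listed : ∀ {e₀ s₀} → e₀ ≤ s₀ → k ≡ e₀ + T s₀ → lastIndex c (suc p) ∸ suc s ≡ m →
    Listed c k p e₀ s₀ (L c k (suc p) 1ℙ)
  level-listed e₀≤s₀ k≡₀ m≡ with z , start-z , path ← blocks-listed m 0ℙ ≤-refl =
    listed (start-isLast t start-z) (subst₂ (Path Near z)
      (sym (L-blocks c (suc p) e<s k≡ m≡))
      (sym (full-carry c (carry e₀≤s₀ e<s (trans (sym k≡₀) k≡))))
      path)

first-zero : ∀ {n} (c : Vec ℕ n) {e s} → e + T s ≡ 0 → first c e s ≡ c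
first-zero c {e} {s} eq with m+n≡0⇒m≡0 e eq
... | refl = trans (cong (λ c → full c s) (ε-zero c _)) (full-zero c {s} eq)

L-listed : ∀ {n} {c : Vec ℕ n} {k p e s} → Acc _<_ k → e ≤ s → k ≡ e + T s → State c k p →
  Listed c k p e s (L c k (suc p) 1ℙ)
L-listed {c = c} {zero} {e = e} {s} _ e≤s k≡ st = listed (nil refl refl)
  (subst (Path Near c (c ∷ [])) (sym (first-zero c {e} {s} (sym k≡))) [ c ])
L-listed {k = k@(suc _)} (acc rs) e≤s k≡ st =
  let e′ , s′ , e′<s′ , k≡′ = decompose k z<s
      m , m≡ , t = top st e′<s′ k≡′
  in level-listed st e′<s′ k≡′ t (λ k′<k → L-listed (rs k′<k)) e≤s k≡ m≡

-- ψ as a product of rotations of ℕ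

-- Iterating a single shift makes sense for every exponent, whereas `shift u k` is the rotation only
-- for `k ≤ u`; the intermediate sequences of a path may exceed that bound.
rotate : ℕ → ℕ → ℕ → ℕ
rotate u zero    x = x
rotate u (suc k) x = shift u 1 (rotate u k x)

rotate-shift : ∀ u k x → rotate u k (shift u 1 x) ≡ shift u 1 (rotate u k x)
rotate-shift u zero    x = refl
rotate-shift u (suc k) x = cong (shift u 1) (rotate-shift u k x)

shift-zero : ∀ u x → shift u 0 x ≡ x
shift-zero u x with <-≤-connex x u
... | inj₁ x<u = shift-second u 0 x z≤n x<u
... | inj₂ u≤x = shift-third u 0 x z≤n u≤x

shift-suc : ∀ u k x → suc k ≤ u → shift u 1 (shift u k x) ≡ shift u (suc k) x
shift-suc u k x k<u with <-cmp x k
... | tri< x<k _ _ = begin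
  shift u 1 (shift u k x) ≡⟨ cong (shift u 1) (shift-first u k x x<k) ⟩
  shift u 1 (u ∸ k + x)   ≡⟨ shift-second u 1 _ (≤-trans (m<n⇒0<n∸m k<u) (m≤m+n _ x)) (u∸k+x<u (<⇒≤ k<u) x<k) ⟩
  u ∸ k + x ∸ 1           ≡⟨ cong (λ y → y + x ∸ 1) (suc-pred (u ∸ k) {{>-nonZero (m<n⇒0<n∸m k<u)}}) ⟨
  pred (u ∸ k) + x        ≡⟨ cong (_+ x) (pred[m∸n]≡m∸[1+n] u k) ⟩
  u ∸ suc k + x           ≡⟨ shift-first u (suc k) x (m<n⇒m<1+n x<k) ⟨
  shift u (suc k) x       ∎
  where open ≡-Reasoning
... | tri≈ _ refl _ = begin
  shift u 1 (shift u k k) ≡⟨ cong (shift u 1) (trans (shift-second u k k ≤-refl k<u) (n∸n≡0 k)) ⟩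
  shift u 1 0             ≡⟨ shift-first u 1 0 z<s ⟩
  u ∸ 1 + 0               ≡⟨ +-identityʳ (u ∸ 1) ⟩
  u ∸ 1                   ≡⟨ cong (_∸ 1) (m∸n+n≡m k<u) ⟨
  u ∸ suc k + suc k ∸ 1   ≡⟨ cong (_∸ 1) (+-suc (u ∸ suc k) k) ⟩
  u ∸ suc k + k           ≡⟨ shift-first u (suc k) k ≤-refl ⟨
  shift u (suc k) k       ∎
  where open ≡-Reasoning
... | tri> _ _ k<x with <-≤-connex x u
...   | inj₁ x<u = begin
  shift u 1 (shift u k x) ≡⟨ cong (shift u 1) (shift-second u k x (<⇒≤ k<x) x<u) ⟩
  shift u 1 (x ∸ k)       ≡⟨ shift-second u 1 _ (m<n⇒0<n∸m k<x) (≤-<-trans (m∸n≤m x k) x<u) ⟩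
  x ∸ k ∸ 1               ≡⟨ ∸-+-assoc x k 1 ⟩
  x ∸ (k + 1)             ≡⟨ cong (x ∸_) (+-comm k 1) ⟩
  x ∸ suc k               ≡⟨ shift-second u (suc k) x k<x x<u ⟨
  shift u (suc k) x       ∎
  where open ≡-Reasoning
...   | inj₂ u≤x = begin
  shift u 1 (shift u k x) ≡⟨ cong (shift u 1) (shift-third u k x (<⇒≤ k<u) u≤x) ⟩
  shift u 1 x             ≡⟨ shift-third u 1 x (≤-trans (s≤s z≤n) k<u) u≤x ⟩
  x                       ≡⟨ shift-third u (suc k) x k<u u≤x ⟨
  shift u (suc k) x       ∎
  where open ≡-Reasoning

rotate≡shift : ∀ u k x → k ≤ u → rotate u k x ≡ shift u k x
rotate≡shift u zero    x _   = sym (shift-zero u x)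
rotate≡shift u (suc k) x k<u = trans (cong (shift u 1) (rotate≡shift u k x (<⇒≤ k<u))) (shift-suc u k x k<u)

shift-injective : ∀ u k {x y} → k ≤ u → shift u k x ≡ shift u k y → x ≡ y
shift-injective u k {x} {y} k≤u eq = trans (sym (shift-inverse u k x k≤u))
  (trans (cong (shift u (u ∸ k)) eq) (shift-inverse u k y k≤u))

rotate-injective : ∀ u k {x y} → rotate (suc u) k x ≡ rotate (suc u) k y → x ≡ y
rotate-injective u zero    eq = eq
rotate-injective u (suc k) eq = rotate-injective u k (shift-injective (suc u) 1 (s≤s z≤n) eq)

rotate-fixes : ∀ u k {x} → suc u ≤ x → rotate (suc u) k x ≡ x
rotate-fixes u zero    u<x = refl
rotate-fixes u (suc k) u<x = trans (cong (shift (suc u) 1) (rotate-fixes u k u<x))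
  (shift-third (suc u) 1 _ (s≤s z≤n) u<x)

rotate-surjective : ∀ u k y → ∃ λ x → rotate (suc u) k x ≡ y
rotate-surjective u zero    y = y , refl
rotate-surjective u (suc k) y with rotate-surjective u k (shift (suc u) u y)
... | x , eq = x , trans (cong (shift (suc u) 1) eq) (shift-inverse′ (suc u) 1 y (s≤s z≤n))

-- [[m,t_m]] · … · [[1,t_1]] for arbitrary exponents t_i ∈ ℕ, as a map on ℕ.
word : (ℕ → ℕ) → ℕ → ℕ → ℕ
word t zero    x = x
word t (suc m) x = rotate (suc m) (t m) (word t m x)

word-cong : ∀ {t t′} m → (∀ i → i < m → t i ≡ t′ i) → ∀ x → word t m x ≡ word t′ m x
word-cong zero    eq x = refl
word-cong (suc m) eq x = cong₂ (rotate (suc m)) (eq m ≤-refl) (word-cong m (λ i i<m → eq i (m<n⇒m<1+n i<m)) x)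

module _ (t : ℕ → ℕ) where

  word-injective : ∀ m {x y} → word t m x ≡ word t m y → x ≡ y
  word-injective zero    eq = eq
  word-injective (suc m) eq = word-injective m (rotate-injective m (t m) eq)

  word-fixes : ∀ m {x} → m ≤ x → word t m x ≡ x
  word-fixes zero    m≤x = refl
  word-fixes (suc m) m<x = trans (cong (rotate (suc m) (t m)) (word-fixes m (<⇒≤ m<x))) (rotate-fixes m (t m) m<x)

  word-surjective : ∀ m y → ∃ λ x → word t m x ≡ y
  word-surjective zero    y = y , refl
  word-surjective (suc m) y with rotate-surjective m (t m) y
  ... | z , eq with word-surjective m z
  ...   | x , eq′ = x , trans (cong (rotate (suc m) (t m)) eq′) eq

shiftProduct-word : ∀ {n} (t : S n) m (m≤n : m ≤ n) x →
  toℕ (shiftProduct t m m≤n ⟨$⟩ʳ x) ≡ word (at (proj₁ t)) m (toℕ x)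
shiftProduct-word t zero    _   x = refl
shiftProduct-word t@(c , sub) (suc m) m<n x = begin
  toℕ (shiftProduct t (suc m) m<n ⟨$⟩ʳ x)
    ≡⟨ Fin.toℕ-fromℕ< _ ⟩
  shift (suc (toℕ j)) (lookup c j) (toℕ (shiftProduct t m (<⇒≤ m<n) ⟨$⟩ʳ x))
    ≡⟨ cong₂ (λ i a → shift (suc i) a (toℕ (shiftProduct t m (<⇒≤ m<n) ⟨$⟩ʳ x))) (Fin.toℕ-fromℕ< m<n) (at-fromℕ< c m<n) ⟩
  shift (suc m) (at c m) (toℕ (shiftProduct t m (<⇒≤ m<n) ⟨$⟩ʳ x))
    ≡⟨ cong (shift (suc m) (at c m)) (shiftProduct-word t m (<⇒≤ m<n) x) ⟩
  shift (suc m) (at c m) (word (at c) m (toℕ x))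
    ≡⟨ rotate≡shift (suc m) (at c m) _ (m≤n⇒m≤1+n c≤m) ⟨
  word (at c) (suc m) (toℕ x) ∎
  where
  open ≡-Reasoning
  j = fromℕ< m<n
  c≤m : at c m ≤ m
  c≤m = subst₂ _≤_ (at-fromℕ< c m<n) (Fin.toℕ-fromℕ< m<n) (sub j)

ψ-word : ∀ {n} (t : S n) x → toℕ (ψ t ⟨$⟩ʳ x) ≡ word (at (proj₁ t)) n (toℕ x)
ψ-word {n} t = shiftProduct-word t n ≤-refl

-- On 0-based values, R_{p+2} and R_{p+1} differ only at 0 and p + 1.
shift-transpose : ∀ p w → w ≢ 0 → w ≢ suc p → shift (suc (suc p)) 1 w ≡ shift (suc p) 1 w
shift-transpose p w w≢0 w≢1+p with <-≤-connex w (suc p)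
... | inj₁ w<1+p = trans (shift-second (suc (suc p)) 1 w (n≢0⇒n>0 w≢0) (m<n⇒m<1+n w<1+p))
  (sym (shift-second (suc p) 1 w (n≢0⇒n>0 w≢0) w<1+p))
... | inj₂ 1+p≤w = trans (shift-third (suc (suc p)) 1 w (s≤s z≤n) (≤∧≢⇒< 1+p≤w (w≢1+p ∘ sym)))
  (sym (shift-third (suc p) 1 w (s≤s z≤n) 1+p≤w))

module _ {n : ℕ} (g : Vec ℕ n) {p : ℕ} (p+1<n : suc p < n) where

  private
    a b : Vec ℕ n
    a = g ⊕[ 1 ] suc p
    b = g ⊕[ 1 ] suc (suc p)
    Q : ℕ → ℕ
    Q = word (at g) (suc p)
    p<n : p < n
    p<n = <-trans ≤-refl p+1<n
    below-a : ∀ i → i < p → at a i ≡ at g i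
    below-a i i<p = at-ε-≢ g 1 (<⇒≢ i<p)
    below-b : ∀ i → i < suc p → at b i ≡ at g i
    below-b i i<1+p = at-ε-≢ g 1 (<⇒≢ i<1+p)

  word-a : ∀ x → word (at a) (suc (suc p)) x ≡ rotate (suc (suc p)) (at g (suc p)) (shift (suc p) 1 (Q x))
  word-a x = cong₂ (rotate (suc (suc p))) (at-ε-≢ g 1 1+n≢n)
    (cong₂ (rotate (suc p)) (trans (at-ε g 1 p<n) (+-comm (at g p) 1)) (word-cong p below-a x))

  -- The extra unit is pulled past the other powers of the same rotation, so that the two words
  -- differ only in the single shift applied directly to `Q x`.
  word-b : ∀ x → word (at b) (suc (suc p)) x ≡ rotate (suc (suc p)) (at g (suc p)) (shift (suc (suc p)) 1 (Q x))
  word-b x = trans (cong₂ (rotate (suc (suc p))) (trans (at-ε g 1 p+1<n) (+-comm (at g (suc p)) 1))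
      (word-cong (suc p) below-b x))
    (sym (rotate-shift (suc (suc p)) (at g (suc p)) (Q x)))

  word-above : ∀ m → suc (suc p) ≤ m → ∀ {x y} →
    word (at b) (suc (suc p)) x ≡ word (at a) (suc (suc p)) y → word (at b) m x ≡ word (at a) m y
  word-above (suc m) p+2≤1+m eq with suc (suc p) ≟ suc m
  ... | yes refl = eq
  ... | no neq   = cong₂ (rotate (suc m))
    (trans (at-ε-≢ g 1 (>⇒≢ p+1<m)) (sym (at-ε-≢ g 1 (>⇒≢ (<-trans ≤-refl p+1<m)))))
    (word-above m p+1<m eq)
    where
    p+1<m : suc p < m
    p+1<m = s≤s⁻¹ (≤∧≢⇒< p+2≤1+m neq)

  -- The transposition of 0 and p + 1 appears to the left of `Q`; moved to its right, it becomes
  -- that of the preimages of 0 and p + 1 under `Q`. The latter preimage is p + 1 itself.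
  move-transposition : ∃₂ λ i j → i ≢ j ×
    (∀ z → word (at b) n (toℕ z) ≡ word (at a) n (toℕ (transpose i j ⟨$⟩ʳ z)))
  move-transposition = i , j , i≢j , λ z → word-above n p+1<n (case-z z)
    where
    x₀ : ℕ
    x₀ = proj₁ (word-surjective (at g) (suc p) 0)
    Qx₀ : Q x₀ ≡ 0
    Qx₀ = proj₂ (word-surjective (at g) (suc p) 0)
    -- A preimage in ℕ could lie outside the range, but there `Q` is the identity and does not take
    -- the value 0.
    x₀<n : x₀ < n
    x₀<n = ≰⇒> λ n≤x₀ → <⇒≢ (<-≤-trans (≤-<-trans z≤n p+1<n) n≤x₀)
      (sym (trans (sym (word-fixes (at g) (suc p) (≤-trans (<⇒≤ p+1<n) n≤x₀))) Qx₀))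
    i j : Fin n
    i = fromℕ< x₀<n
    j = fromℕ< p+1<n
    Qi : Q (toℕ i) ≡ 0
    Qi = trans (cong Q (Fin.toℕ-fromℕ< x₀<n)) Qx₀
    Qj : Q (toℕ j) ≡ suc p
    Qj = trans (cong Q (Fin.toℕ-fromℕ< p+1<n)) (word-fixes (at g) (suc p) ≤-refl)
    i≢j : i ≢ j
    i≢j i≡j = 0≢1+n (trans (sym Qi) (trans (cong (Q ∘ toℕ) i≡j) Qj))
    R = rotate (suc (suc p)) (at g (suc p))
    through : ∀ x y → shift (suc (suc p)) 1 (Q x) ≡ shift (suc p) 1 (Q y) →
      word (at b) (suc (suc p)) x ≡ word (at a) (suc (suc p)) y
    through x y eq = trans (word-b x) (trans (cong R eq) (sym (word-a y)))
    case-z : ∀ z → word (at b) (suc (suc p)) (toℕ z) ≡ word (at a) (suc (suc p)) (toℕ (transpose i j ⟨$⟩ʳ z))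
    case-z z with z Fin.≟ i
    ... | yes refl = through (toℕ i) (toℕ j) (begin
      shift (suc (suc p)) 1 (Q (toℕ i)) ≡⟨ cong (shift (suc (suc p)) 1) Qi ⟩
      shift (suc (suc p)) 1 0           ≡⟨ shift-first (suc (suc p)) 1 0 z<s ⟩
      suc p + 0                         ≡⟨ +-identityʳ (suc p) ⟩
      suc p                             ≡⟨ shift-third (suc p) 1 (suc p) (s≤s z≤n) ≤-refl ⟨
      shift (suc p) 1 (suc p)           ≡⟨ cong (shift (suc p) 1) Qj ⟨
      shift (suc p) 1 (Q (toℕ j))       ∎)
      where open ≡-Reasoning
    ... | no z≢i with z Fin.≟ j
    ...   | yes refl = through (toℕ j) (toℕ i) (begin
      shift (suc (suc p)) 1 (Q (toℕ j)) ≡⟨ cong (shift (suc (suc p)) 1) Qj ⟩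
      shift (suc (suc p)) 1 (suc p)     ≡⟨ shift-second (suc (suc p)) 1 (suc p) (s≤s z≤n) ≤-refl ⟩
      p                                 ≡⟨ +-identityʳ p ⟨
      p + 0                             ≡⟨ shift-first (suc p) 1 0 z<s ⟨
      shift (suc p) 1 0                 ≡⟨ cong (shift (suc p) 1) Qi ⟨
      shift (suc p) 1 (Q (toℕ i))       ∎)
      where open ≡-Reasoning
    ...   | no z≢j = through (toℕ z) (toℕ z) (shift-transpose p (Q (toℕ z))
      (λ eq → z≢i (Fin.toℕ-injective (word-injective (at g) (suc p) (trans eq (sym Qi)))))
      (λ eq → z≢j (Fin.toℕ-injective (word-injective (at g) (suc p) (trans eq (sym Qj))))))

step-transposition : ∀ {n} {a b : Vec ℕ n} → Step a b → ∃₂ λ i j → i ≢ j ×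
  (∀ z → word (at b) n (toℕ z) ≡ word (at a) n (toℕ (transpose i j ⟨$⟩ʳ z)))
step-transposition (inj₁ (g , p , p+1<n , refl , refl)) = move-transposition g p+1<n
step-transposition {n} {a} {b} (inj₂ (g , p , p+1<n , refl , refl)) with move-transposition g p+1<n
... | i , j , i≢j , eq = j , i , i≢j ∘ sym , λ z →
  sym (trans (eq (transpose j i ⟨$⟩ʳ z)) (cong (word (at b) n ∘ toℕ) (PC.transpose-inverse i j)))

steps-transpositions : ∀ {n m} {a b : Vec ℕ n} → Steps m a b → ∃ λ θs →
  length θs ≤ m × All IsTransposition θs ×
  (∀ z → word (at b) n (toℕ z) ≡ word (at a) n (toℕ (foldr _·_ id θs ⟨$⟩ʳ z)))
steps-transpositions done = [] , z≤n , [] , λ z → refl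
steps-transpositions {b = c} (_∷_ {a = a} {b} s ss) with step-transposition s | steps-transpositions ss
... | i , j , i≢j , eq | θs , len , trs , eq′ =
  transpose i j ∷ θs , s≤s len , (i , j , i≢j , λ _ → refl) ∷ trs ,
  λ z → trans (eq′ z) (eq (foldr _·_ id θs ⟨$⟩ʳ z))

steps-differ : ∀ {n m} (s t : S n) → Steps m (proj₁ s) (proj₁ t) → DifferByAtMost m (ψ s) (ψ t)
steps-differ s t ss with steps-transpositions ss
... | θs , len , trs , eq = θs , len , trs , λ z → Fin.toℕ-injective
  (trans (ψ-word t z) (trans (eq z) (sym (ψ-word s (foldr _·_ id θs ⟨$⟩ʳ z)))))

-- Major index and bijectivity of ψ

descentAt : (ℕ → ℕ) → ℕ → ℕ
descentAt f i = if does (f (suc i) <? f i) then suc i else 0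

descents : (ℕ → ℕ) → ℕ → ℕ
descents f = sumTo (descentAt f)

sumTo-front : ∀ f m → sumTo f (suc m) ≡ f 0 + sumTo (f ∘ suc) m
sumTo-front f zero    = refl
sumTo-front f (suc m) = begin
  f (suc m) + sumTo f (suc m)              ≡⟨ cong (f (suc m) +_) (sumTo-front f m) ⟩
  f (suc m) + (f 0 + sumTo (f ∘ suc) m)    ≡⟨ +-assoc (f (suc m)) (f 0) _ ⟨
  f (suc m) + f 0 + sumTo (f ∘ suc) m      ≡⟨ cong (_+ sumTo (f ∘ suc) m) (+-comm (f (suc m)) (f 0)) ⟩
  f 0 + f (suc m) + sumTo (f ∘ suc) m      ≡⟨ +-assoc (f 0) (f (suc m)) _ ⟩
  f 0 + sumTo (f ∘ suc) (suc m)            ∎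
  where open ≡-Reasoning

sum-tabulate : ∀ {m} (w : Fin m → ℕ) f → (∀ i → w i ≡ f (toℕ i)) → sum (List.tabulate w) ≡ sumTo f m
sum-tabulate {zero}  w f eq = refl
sum-tabulate {suc m} w f eq = trans
  (cong₂ _+_ (eq zero) (sum-tabulate (w ∘ suc) (f ∘ suc) (eq ∘ suc))) (sym (sumTo-front f m))

sum-filter : ∀ {A : Set} {P : Pred A 0ℓ} (P? : Decidable P) (h : A → ℕ) xs →
  sum (map h (filter P? xs)) ≡ sum (map (λ x → if does (P? x) then h x else 0) xs)
sum-filter P? h []       = refl
sum-filter P? h (x ∷ xs) with P? x
... | yes _ = cong (h x +_) (sum-filter P? h xs)
... | no  _ = sum-filter P? h xs

majorIndex-descents : ∀ {m} (π : Permutation′ (suc m)) f → (∀ x → toℕ (π ⟨$⟩ʳ x) ≡ f (toℕ x)) →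
  majorIndex π ≡ descents f m
majorIndex-descents {m} π f eq = begin
  majorIndex π               ≡⟨ sum-filter P? (suc ∘ toℕ) (allFin m) ⟩
  sum (map w (allFin m))     ≡⟨ cong sum (List.map-tabulate (λ i → i) w) ⟩
  sum (List.tabulate w)      ≡⟨ sum-tabulate w (descentAt f) w≡ ⟩
  descents f m               ∎
  where
  open ≡-Reasoning
  P? = λ (i : Fin m) → (π ⟨$⟩ʳ suc i) Fin.<? (π ⟨$⟩ʳ inject₁ i)
  w : Fin m → ℕ
  w i = if does (P? i) then suc (toℕ i) else 0
  w≡ : ∀ i → w i ≡ descentAt f (toℕ i)
  w≡ i = cong₂ (λ x y → if does (x <? y) then suc (toℕ i) else 0) (eq (suc i))
    (trans (eq (inject₁ i)) (cong f (Fin.toℕ-inject₁ i)))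

module _ {f : ℕ → ℕ} {i : ℕ} where

  descentAt-< : f (suc i) < f i → descentAt f i ≡ suc i
  descentAt-< lt = cong (if_then suc i else 0) (dec-true (f (suc i) <? f i) lt)

  descentAt-≥ : f i ≤ f (suc i) → descentAt f i ≡ 0
  descentAt-≥ ge = cong (if_then suc i else 0) (dec-false (f (suc i) <? f i) (≤⇒≯ ge))

-- Cyclically lowering the values 0, …, M moves the descent next to the value 0
-- one place to the right.
module _ (g : ℕ → ℕ) (M : ℕ) (g-injective : ∀ {x y} → g x ≡ g y → x ≡ y)
         (g≤M : ∀ i → i ≤ M → g i ≤ M) where

  private
    h : ℕ → ℕ
    h i = shift (suc M) 1 (g i)

    h-suc : ∀ {i} → i ≤ M → g i ≢ 0 → suc (h i) ≡ g i
    h-suc {i} i≤M gi≢0 = trans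
      (cong suc (shift-second (suc M) 1 (g i) (n≢0⇒n>0 gi≢0) (s≤s (g≤M i i≤M))))
      (m+[n∸m]≡n (n≢0⇒n>0 gi≢0))

    h-zero : ∀ {i} → g i ≡ 0 → h i ≡ M
    h-zero {i} gi≡0 = trans (cong (shift (suc M) 1) gi≡0) (trans (shift-first (suc M) 1 0 z<s) (+-identityʳ M))

    h<M : ∀ {i} → i ≤ M → g i ≢ 0 → h i < M
    h<M {i} i≤M gi≢0 = ≤-trans (≤-reflexive (h-suc i≤M gi≢0)) (g≤M i i≤M)

    descentAt-h : ∀ {i} → suc i ≤ M → g i ≢ 0 → g (suc i) ≢ 0 → descentAt h i ≡ descentAt g i
    descentAt-h {i} i<M gi≢0 gi+1≢0 with <-≤-connex (g (suc i)) (g i)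
    ... | inj₁ lt = trans (descentAt-< {h} (s≤s⁻¹ (subst₂ _<_ (sym (h-suc i<M gi+1≢0)) (sym (h-suc (<⇒≤ i<M) gi≢0)) lt)))
                          (sym (descentAt-< {g} lt))
    ... | inj₂ ge = trans (descentAt-≥ {h} (s≤s⁻¹ (subst₂ _≤_ (sym (h-suc (<⇒≤ i<M) gi≢0)) (sym (h-suc i<M gi+1≢0)) ge)))
                          (sym (descentAt-≥ {g} ge))

  module _ {p : ℕ} (p<M : p < M) (gp≡0 : g p ≡ 0) where

    private
      g≢0 : ∀ {i} → i ≢ p → g i ≢ 0
      g≢0 i≢p gi≡0 = i≢p (g-injective (trans gi≡0 (sym gp≡0)))

      before : ∀ m → m < p → descents h m ≡ descents g m
      before zero    _   = refl
      before (suc m) m<p = cong₂ _+_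
        (descentAt-h (<⇒≤ (<-trans m<p p<M)) (g≢0 (<⇒≢ (<-trans ≤-refl m<p))) (g≢0 (<⇒≢ m<p)))
        (before m (<-trans ≤-refl m<p))

      -- The descent of `g` into the value 0 is lost, because 0 becomes the maximum `M`. It
      -- contributed its position `p`; for `p` = 0 there is none and nothing is lost.
      just-at : ∀ m → m ≡ p → descents h m + m ≡ descents g m
      just-at zero    _    = refl
      just-at (suc m) refl = begin
        descentAt h m + descents h m + suc m ≡⟨ cong₂ (λ x y → x + y + suc m)
          (descentAt-≥ {h} (≤-trans (<⇒≤ (h<M m≤M gm≢0)) (≤-reflexive (sym (h-zero gp≡0))))) (before m ≤-refl) ⟩
        descents g m + suc m                 ≡⟨ +-comm (descents g m) (suc m) ⟩
        suc m + descents g m                 ≡⟨ cong (_+ descents g m)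
          (descentAt-< {g} (≤-trans (≤-reflexive (cong suc gp≡0)) (n≢0⇒n>0 gm≢0))) ⟨
        descentAt g m + descents g m         ∎
        where
        open ≡-Reasoning
        m≤M : m ≤ M
        m≤M = <⇒≤ (<-trans ≤-refl p<M)
        gm≢0 : g m ≢ 0
        gm≢0 = g≢0 (<⇒≢ ≤-refl)

      after : ∀ m → p < m → m ≤ M → descents h m ≡ suc (descents g m)
      after (suc m) p<1+m m<M with m ≟ p
      ... | yes refl = begin
        descentAt h m + descents h m ≡⟨ cong (_+ descents h m) (descentAt-< {h}
          (<-≤-trans (h<M m<M (g≢0 1+n≢n)) (≤-reflexive (sym (h-zero gp≡0))))) ⟩
        suc m + descents h m         ≡⟨ cong suc (trans (+-comm m _) (just-at m refl)) ⟩
        suc (descents g m)           ≡⟨ cong (λ d → suc (d + descents g m))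
          (descentAt-≥ {g} (≤-trans (≤-reflexive gp≡0) z≤n)) ⟨
        suc (descents g (suc m))     ∎
        where open ≡-Reasoning
      ... | no m≢p = trans
        (cong₂ _+_ (descentAt-h m<M (g≢0 m≢p) (g≢0 (>⇒≢ p<1+m)))
          (after m (≤∧≢⇒< (s≤s⁻¹ p<1+m) (m≢p ∘ sym)) (<⇒≤ m<M)))
        (+-suc (descentAt g m) (descents g m))

    descents-shift : descents h M ≡ suc (descents g M)
    descents-shift = after M p<M ≤-refl

module _ (t : ℕ → ℕ) (m : ℕ) where

  private
    g : ℕ → ℕ → ℕ
    g k x = rotate (suc m) k (word t m x)

    g-injective : ∀ k {x y} → g k x ≡ g k y → x ≡ y
    g-injective k eq = word-injective t m (rotate-injective m k eq)

    g-fixes : ∀ k {x} → m < x → g k x ≡ x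
    g-fixes k m<x = trans (cong (rotate (suc m) k) (word-fixes t m (<⇒≤ m<x))) (rotate-fixes m k m<x)

    g≤m : ∀ k i → i ≤ m → g k i ≤ m
    g≤m k i i≤m = ≮⇒≥ λ m<gi → <⇒≱ m<gi (subst (_≤ m) (sym (g-injective k (g-fixes k m<gi))) i≤m)

  rotate-last : ∀ k → k ≤ m → g k m ≡ m ∸ k
  rotate-last k k≤m = trans (cong (rotate (suc m) k) (word-fixes t m ≤-refl))
    (trans (rotate≡shift (suc m) k m (m≤n⇒m≤1+n k≤m)) (shift-second (suc m) k m k≤m ≤-refl))

  descents-rotate : ∀ k → k ≤ m → descents (g k) m ≡ k + descents (word t m) m
  descents-rotate zero    _   = refl
  descents-rotate (suc k) k<m with rotate-surjective m k 0
  ... | y , y↦0 with word-surjective t m y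
  ...   | p , p↦y = trans (descents-shift (g k) m (g-injective k) (g≤m k) p<m gp≡0)
    (cong suc (descents-rotate k (<⇒≤ k<m)))
    where
    gp≡0 : g k p ≡ 0
    gp≡0 = trans (cong (rotate (suc m) k) p↦y) y↦0
    -- The value 0 still has a neighbour on its right: the last value is m - k, which is positive,
    -- and beyond `m` every point is fixed.
    p<m : p < m
    p<m with <-cmp p m
    ... | tri< lt _ _   = lt
    ... | tri≈ _ refl _ = contradiction (trans (sym gp≡0) (rotate-last k (<⇒≤ k<m))) (<⇒≢ (m<n⇒0<n∸m k<m))
    ... | tri> _ _ gt   = contradiction (trans (sym gp≡0) (g-fixes k gt)) (<⇒≢ (≤-<-trans z≤n gt))

-- The last value of the word on m letters is the largest, so appending it creates no descent.
descents-fixed : ∀ t m → descents (word t m) m ≡ descents (word t m) (pred m)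
descents-fixed t zero    = refl
descents-fixed t (suc m) = cong (_+ descents (word t (suc m)) m) (descentAt-≥ {word t (suc m)}
  (subst (word t (suc m) m ≤_) (sym (word-fixes t (suc m) ≤-refl))
    (≮⇒≥ λ lt → <⇒≢ (<-trans ≤-refl lt)
      (sym (word-injective t (suc m) (word-fixes t (suc m) (<⇒≤ lt)))))))

descents-word : ∀ t m → (∀ i → t i ≤ i) → descents (word t m) (pred m) ≡ sumTo t m
descents-word t zero    t≤ = refl
descents-word t (suc m) t≤ = begin
  descents (word t (suc m)) m          ≡⟨ descents-rotate t m (t m) (t≤ m) ⟩
  t m + descents (word t m) m          ≡⟨ cong (t m +_) (trans (descents-fixed t m) (descents-word t m t≤)) ⟩
  t m + sumTo t m                      ∎
  where open ≡-Reasoning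

word-unique : ∀ {t t′} m → (∀ i → t i ≤ i) → (∀ i → t′ i ≤ i) →
  (∀ x → word t m x ≡ word t′ m x) → ∀ i → i < m → t i ≡ t′ i
word-unique {t} {t′} (suc m) t≤ t′≤ eq i i<1+m with i ≟ m | same-exponent
  where
  same-exponent : t m ≡ t′ m
  same-exponent = ∸-cancelˡ-≡ (t≤ m) (t′≤ m)
    (trans (sym (rotate-last t m (t m) (t≤ m))) (trans (eq m) (rotate-last t′ m (t′ m) (t′≤ m))))
... | yes refl | tm≡t′m = tm≡t′m
... | no i≢m   | tm≡t′m = word-unique m t≤ t′≤
  (λ x → rotate-injective m (t m) (trans (eq x) (cong (λ k → rotate (suc m) k (word t′ m x)) (sym tm≡t′m))))
  i (≤∧≢⇒< (s≤s⁻¹ i<1+m) i≢m)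

-- Taking `k = m ∸ h m` makes `k` shifts send m to `h m`; undoing them by `suc m ∸ k` further shifts
-- gives a map that fixes m as well, to which induction applies. Working with injections of ℕ keeps
-- one type for all lengths.
word-complete : ∀ m (h : ℕ → ℕ) → (∀ {x y} → h x ≡ h y → x ≡ y) → (∀ {x} → m ≤ x → h x ≡ x) →
  ∃ λ t → (∀ i → t i ≤ i) × (∀ x → word t m x ≡ h x)
word-complete zero    h h-injective h-fixes = (λ _ → 0) , (λ _ → z≤n) , λ x → sym (h-fixes z≤n)
word-complete (suc m) h h-injective h-fixes = t , t≤ , word-t
  where
  hm≤m : h m ≤ m
  hm≤m = ≮⇒≥ λ m<hm → <⇒≢ m<hm (sym (h-injective (h-fixes m<hm)))
  k : ℕ
  k = m ∸ h m
  k≤m : k ≤ m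
  k≤m = m∸n≤m m (h m)
  h′ : ℕ → ℕ
  h′ x = shift (suc m) (suc m ∸ k) (h x)
  shift-m : shift (suc m) k m ≡ h m
  shift-m = trans (shift-second (suc m) k m k≤m ≤-refl) (m∸[m∸n]≡n hm≤m)
  h′-fixes : ∀ {x} → m ≤ x → h′ x ≡ x
  h′-fixes {x} m≤x with m ≟ x
  ... | yes refl = trans (cong (shift (suc m) (suc m ∸ k)) (sym shift-m)) (shift-inverse (suc m) k m (m≤n⇒m≤1+n k≤m))
  ... | no m≢x   = trans (cong (shift (suc m) (suc m ∸ k)) (h-fixes m<x))
    (shift-third (suc m) (suc m ∸ k) x (m∸n≤m (suc m) k) m<x)
    where
    m<x : m < x
    m<x = ≤∧≢⇒< m≤x m≢x
  rest : ∃ λ t → (∀ i → t i ≤ i) × (∀ x → word t m x ≡ h′ x)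
  rest = word-complete m h′ (λ eq → h-injective (shift-injective (suc m) (suc m ∸ k) (m∸n≤m (suc m) k) eq)) h′-fixes
  t′ : ℕ → ℕ
  t′ = proj₁ rest
  t : ℕ → ℕ
  t i = if does (i ≟ m) then k else t′ i
  t-m : t m ≡ k
  t-m = cong (if_then k else t′ m) (dec-true (m ≟ m) refl)
  t-≢ : ∀ {i} → i ≢ m → t i ≡ t′ i
  t-≢ {i} i≢m = cong (if_then k else t′ i) (dec-false (i ≟ m) i≢m)
  t≤ : ∀ i → t i ≤ i
  t≤ i = case i ≟ m of λ
    { (yes refl) → ≤-trans (≤-reflexive t-m) k≤m
    ; (no i≢m)   → ≤-trans (≤-reflexive (t-≢ i≢m)) (proj₁ (proj₂ rest) i) }
  word-t : ∀ x → word t (suc m) x ≡ h x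
  word-t x = begin
    rotate (suc m) (t m) (word t m x) ≡⟨ cong₂ (rotate (suc m)) t-m (word-cong m (λ i i<m → t-≢ (<⇒≢ i<m)) x) ⟩
    rotate (suc m) k (word t′ m x)    ≡⟨ cong (rotate (suc m) k) (proj₂ (proj₂ rest) x) ⟩
    rotate (suc m) k (h′ x)           ≡⟨ rotate≡shift (suc m) k (h′ x) (m≤n⇒m≤1+n k≤m) ⟩
    shift (suc m) k (h′ x)            ≡⟨ shift-inverse′ (suc m) k (h x) (m≤n⇒m≤1+n k≤m) ⟩
    h x                               ∎
    where open ≡-Reasoning

-- Transfer from words on ℕ to `ψ`

at-sub : ∀ {n} (c : Vec ℕ n) → Subexcedant c → ∀ q → at c q ≤ q
at-sub {n} c sub q = case q <? n of λ
  { (yes q<n) → subst₂ _≤_ (at-fromℕ< c q<n) (Fin.toℕ-fromℕ< q<n) (sub (fromℕ< q<n))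
  ; (no q≮n)  → ≤-trans (≤-reflexive (at-≥ c (≮⇒≥ q≮n))) z≤n }

sub-at : ∀ {n} (c : Vec ℕ n) → (∀ q → at c q ≤ q) → Subexcedant c
sub-at c at≤ j = subst (_≤ toℕ j) (at-toℕ c j) (at≤ (toℕ j))

majorIndex-ψ : ∀ {n} (t : S n) π → π ≈ ψ t → majorIndex π ≡ sumTo (at (proj₁ t)) n
majorIndex-ψ {zero}  t         π _  = refl
majorIndex-ψ {suc m} t@(c , sub) π eq = trans
  (majorIndex-descents π (word (at c) (suc m)) λ x → trans (cong toℕ (eq x)) (ψ-word t x))
  (descents-word (at c) (suc m) (at-sub c sub))

ψ-injective : ∀ {n} (s t : S n) → ψ s ≈ ψ t → proj₁ s ≡ proj₁ t
ψ-injective {n} s@(c , sub) t@(c′ , sub′) eq = at-ext λ q → case q <? n of λ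
  { (yes q<n) → word-unique n (at-sub c sub) (at-sub c′ sub′) word-eq q q<n
  ; (no q≮n)  → trans (at-≥ c (≮⇒≥ q≮n)) (sym (at-≥ c′ (≮⇒≥ q≮n))) }
  where
  word-eq : ∀ x → word (at c) n x ≡ word (at c′) n x
  word-eq x with <-≤-connex x n
  ... | inj₂ n≤x = trans (word-fixes (at c) n n≤x) (sym (word-fixes (at c′) n n≤x))
  ... | inj₁ x<n = begin
    word (at c) n x                  ≡⟨ cong (word (at c) n) (Fin.toℕ-fromℕ< x<n) ⟨
    word (at c) n (toℕ (fromℕ< x<n)) ≡⟨ ψ-word s (fromℕ< x<n) ⟨
    toℕ (ψ s ⟨$⟩ʳ fromℕ< x<n)        ≡⟨ cong toℕ (eq (fromℕ< x<n)) ⟩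
    toℕ (ψ t ⟨$⟩ʳ fromℕ< x<n)        ≡⟨ ψ-word t (fromℕ< x<n) ⟩
    word (at c′) n (toℕ (fromℕ< x<n)) ≡⟨ cong (word (at c′) n) (Fin.toℕ-fromℕ< x<n) ⟩
    word (at c′) n x                 ∎
    where open ≡-Reasoning

extend : ∀ {n} → (Fin n → Fin n) → ℕ → ℕ
extend {n} f x with x <? n
... | yes x<n = toℕ (f (fromℕ< x<n))
... | no  _   = x

extend-toℕ : ∀ {n} (f : Fin n → Fin n) x → extend f (toℕ x) ≡ toℕ (f x)
extend-toℕ {n} f x with toℕ x <? n
... | yes x<n = cong (λ y → toℕ (f y)) (Fin.fromℕ<-toℕ x x<n)
... | no x≮n  = contradiction (Fin.toℕ<n x) x≮n

extend-≥ : ∀ {n} (f : Fin n → Fin n) {x} → n ≤ x → extend f x ≡ x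
extend-≥ {n} f {x} n≤x with x <? n
... | yes x<n = contradiction x<n (≤⇒≯ n≤x)
... | no  _   = refl

extend-injective : ∀ {n} {f : Fin n → Fin n} → (∀ {x y} → f x ≡ f y → x ≡ y) →
  ∀ {x y} → extend f x ≡ extend f y → x ≡ y
extend-injective {n} {f} f-injective {x} {y} eq with x <? n | y <? n
... | yes x<n | yes y<n = Fin.fromℕ<-injective x y x<n y<n (f-injective (Fin.toℕ-injective eq))
... | yes x<n | no y≮n  = contradiction (subst (_< n) eq (Fin.toℕ<n _)) y≮n
... | no x≮n  | yes y<n = contradiction (subst (_< n) (sym eq) (Fin.toℕ<n _)) x≮n
... | no _    | no _    = eq

ψ-surjective : ∀ {n} (π : Permutation′ n) → ∃ λ t → π ≈ ψ t
ψ-surjective {n} π with word-complete n (extend (π ⟨$⟩ʳ_)) (extend-injective π-injective) (extend-≥ (π ⟨$⟩ʳ_))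
  where
  π-injective : ∀ {x y} → π ⟨$⟩ʳ x ≡ π ⟨$⟩ʳ y → x ≡ y
  π-injective eq = trans (sym (inverseˡ π)) (trans (cong (π ⟨$⟩ˡ_) eq) (inverseˡ π))
... | t , t≤ , word-t = s , λ x → Fin.toℕ-injective (begin
  toℕ (π ⟨$⟩ʳ x)               ≡⟨ extend-toℕ (π ⟨$⟩ʳ_) x ⟨
  extend (π ⟨$⟩ʳ_) (toℕ x)     ≡⟨ word-t (toℕ x) ⟨
  word t n (toℕ x)             ≡⟨ word-cong n (λ i i<n → at-c i<n) (toℕ x) ⟨
  word (at c) n (toℕ x)        ≡⟨ ψ-word s x ⟨
  toℕ (ψ s ⟨$⟩ʳ x)             ∎)
  where
  open ≡-Reasoning
  c : Vec ℕ n
  c = tabulate (t ∘ toℕ)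
  at-c : ∀ {i} → i < n → at c i ≡ t i
  at-c i<n = trans (sym (at-fromℕ< c i<n)) (trans (Vec.lookup∘tabulate (t ∘ toℕ) (fromℕ< i<n)) (cong t (Fin.toℕ-fromℕ< i<n)))
  s : S n
  s = c , λ j → ≤-trans (≤-reflexive (Vec.lookup∘tabulate (t ∘ toℕ) j)) (t≤ (toℕ j))

-- The resulting list of permutations

module _ {A : Set} {P : Pred A 0ℓ} where

  map-proj₁-toList : ∀ {xs} (pxs : All P xs) → map proj₁ (toList pxs) ≡ xs
  map-proj₁-toList []         = refl
  map-proj₁-toList (px ∷ pxs) = cong (_ ∷_) (map-proj₁-toList pxs)

  any-toList⁻ : ∀ {Q : Pred (Σ A P) 0ℓ} {xs} (pxs : All P xs) → Any Q (toList pxs) →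
    ∃ λ s → proj₁ s ∈ₚ xs × Q s
  any-toList⁻ (px ∷ pxs) (here q)  = _ , here refl , q
  any-toList⁻ (px ∷ pxs) (there q) with any-toList⁻ pxs q
  ... | s , s∈ , qs = s , there s∈ , qs

  any-toList⁺ : ∀ {x xs} (pxs : All P xs) → x ∈ₚ xs → Any (λ s → proj₁ s ≡ x) (toList pxs)
  any-toList⁺ (px ∷ pxs) (here refl) = here refl
  any-toList⁺ (px ∷ pxs) (there x∈)  = there (any-toList⁺ pxs x∈)

at-replicate : ∀ n q → at (replicate n 0) q ≡ 0
at-replicate zero    q       = refl
at-replicate (suc n) zero    = refl
at-replicate (suc n) (suc q) = at-replicate n q

initial : ∀ {n k} → k ≤ T (suc n) → State (replicate (suc n) 0) k n
initial {n} {k} k≤ = record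
  { p<n   = ≤-refl
  ; below = λ q _ → at-replicate (suc n) q
  ; sub   = λ q → ≤-trans (≤-reflexive (at-replicate (suc n) q)) z≤n
  ; room  = ≤-trans (≤-reflexive (trans (cong (k +_) (at-replicate (suc n) n)) (+-identityʳ k))) k≤
  }

module _ {n k : ℕ} {xs : List (Vec ℕ (suc n))}
         (xs-enumerates : Enumerates (replicate (suc n) 0) k n xs) where

  open Enumerates xs-enumerates

  private
    c₀ : Vec ℕ (suc n)
    c₀ = replicate (suc n) 0

    weight₀ : sumTo (at c₀) (suc n) ≡ 0
    weight₀ = sumTo-zero (suc n) λ i _ → at-replicate (suc n) i

    weight-k : ∀ {v} → v ∈ₚ xs → sumTo (at v) (suc n) ≡ k
    weight-k v∈ = trans (Reach.weight (sound v∈)) (cong (_+ k) weight₀)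

  subexcedant : All Subexcedant xs
  subexcedant = All.tabulate λ {v} v∈ → sub-at v (Reach.sub (sound v∈))

  private
    -- Equal sequences may carry different proofs of subexcedance; `word` depends on the sequence
    -- alone.
    ψ-agrees : ∀ π (s t : S (suc n)) → π ≈ ψ t → proj₁ s ≡ proj₁ t → π ≈ ψ s
    ψ-agrees π s t eq refl x = trans (eq x) (Fin.toℕ-injective (trans (ψ-word t x) (sym (ψ-word s x))))

    reach : ∀ π (t : S (suc n)) → π ≈ ψ t → majorIndex π ≡ k → Reach c₀ k n (proj₁ t)
    reach π t@(c , sub) eq maj = record
      { sub    = at-sub c sub
      ; above  = λ q n<q → trans (at-≥ c n<q) (sym (at-≥ c₀ n<q))
      ; grow   = ≤-trans (≤-reflexive (at-replicate (suc n) n)) z≤n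
      ; weight = trans (trans (sym (majorIndex-ψ t π eq)) maj) (sym (cong (_+ k) weight₀))
      }

    to : ∀ π → (∃ λ t → proj₁ t ∈ₚ xs × π ≈ ψ t) → majorIndex π ≡ k
    to π (t , t∈ , eq) = trans (majorIndex-ψ t π eq) (weight-k t∈)

    from : ∀ π → majorIndex π ≡ k → (∃ λ t → π ≈ ψ t) → Any (λ s → π ≈ ψ s) (toList subexcedant)
    from π maj (t , eq) =
      Any.map (λ {s} → ψ-agrees π s t eq) (any-toList⁺ subexcedant (complete (reach π t eq maj)))

  ψ-members : ∀ π → (_∈_ (permutationSetoid (suc n)) π (map ψ (toList subexcedant))) ⇔ (majorIndex π ≡ k)
  ψ-members π = mk⇔ (λ π∈ → to π (any-toList⁻ subexcedant (Any.map⁻ π∈)))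
                    (λ maj → Any.map⁺ (from π maj (ψ-surjective π)))

  ψ-unique : Unique (permutationSetoid (suc n)) (map ψ (toList subexcedant))
  ψ-unique = AllPairs.map⁺ (AllPairs.map (λ {s} {t} c≢ eq → c≢ (ψ-injective s t eq))
    (AllPairs.map⁻ (subst (AllPairs.AllPairs _≢_) (sym (map-proj₁-toList subexcedant)) unique)))

  ψ-linked : Linked Near xs → Linked (DifferByAtMost 3) (map ψ (toList subexcedant))
  ψ-linked near = Linked.map⁺ (Linked.map (λ {s} {t} ss → steps-differ s t ss)
    (Linked.map⁻ (subst (Linked Near) (sym (map-proj₁-toList subexcedant)) near)))

L-linked : ∀ {n} (c : Vec ℕ n) k {p} → State c k p → Linked Near (L c k (suc p) 0ℙ)
L-linked c zero          st = Linked.[-]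
L-linked c k@(suc _) {p} st =
  let e , s , e<s , k≡ = decompose k z<s
  -- `e < s` is passed as `suc e ≤ s`: the parameters of `L-listed` are `suc e` and `s`.
  in path-linked (L-path-reverse c k (suc p) (Listed.path (L-listed (<-wellFounded k) e<s k≡ st)))

mainTheorem2 : (n k : ℕ) → 1 ≤ n → k ≤ n * (n ∸ 1) / 2 →
    Σ (All Subexcedant (𝒮 k n)) λ sub →
    let perms : List (Permutation′ n)
        perms = map ψ (toList sub)
    in ((π : Permutation′ n) → (_∈_ (permutationSetoid n) π perms) ⇔ (majorIndex π ≡ k))
       × Unique (permutationSetoid n) perms
       × Linked (DifferByAtMost 3) perms
mainTheorem2 n@(suc n′) k _ k≤ = subexcedant en , ψ-members en , ψ-unique en ,
  ψ-linked en (L-linked (replicate n 0) k (initial k≤T))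
  where
  k≤T : k ≤ T n
  k≤T = ≤-trans k≤ (≤-reflexive (triangle≡T n))
  en : Enumerates (replicate n 0) k n′ (𝒮 k n)
  en = L-enumerates (replicate n 0) 0ℙ (initial k≤T)
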